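{- For every set $X \subseteq \mathbf{C}$ of infinite binary sequences, $\dim_{\mathrm{P}}(X) = \inf \mathcal{G}^{\mathrm{str}}(X)$, where $\dim_{\mathrm P}(X)$ is the packing dimension of $X$ and $\mathcal{G}^{\mathrm{str}}(X)$ is the set of all $s \in [0,\infty)$ for which there exists an $s$-gale $d$ that succeeds strongly on every element of $X$.
   Context: $\mathbf{C}$ is the Cantor space of all infinite binary sequences. For $S\in\mathbf{C}$, $S[0..n-1]$ is the string of its first $n$ bits. For a string $w\in\{0,1\}^*$, $\mathbf{C}_w$ is the set of all $S\in\mathbf{C}$ having $w$ as a prefix. A prefix set is a set $A\subseteq\{0,1\}^*$ such that no element of $A$ is a (proper) prefix of another element of $A$. Packing dimension. For $k\in\mathbb{N}$ and $X\subseteq\mathbf{C}$, let $\mathcal{B}_k(X)$ be the collection of all prefix sets $A$ that contain no string of length less than $k$ and satisfy $\mathbf{C}_w\cap X\neq\emptyset$ for all $w\in A$. For $s\in[0,\infty)$ let $P_k^s(X)=\sup_{A\in\mathcal{B}_k(X)}\sum_{w\in A}2^{ -s|w|}$, $P_\infty^s(X)=\lim_{k\to\infty}P_k^s(X)$, and $P^s(X)=\inf\{\sum_{i=0}^\infty P_\infty^s(X_i) : X\subseteq\bigcup_{i=0}^\infty X_i\}$ (values may be infinite). The packing dimension of $X$ is $\dim_{\mathrm P}(X)=\inf\{s\in[0,\infty) : P^s(X)=0\}$. Gales. For $s\in[0,\infty)$, an $s$-gale is a function $d:\{0,1\}^*\to[0,\infty)$ with $d(w)=2^{ -s}[d(w0)+d(w1)]$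 for all $w\in\{0,1\}^*$. It succeeds strongly on $S\in\mathbf{C}$ if $\liminf_{n\to\infty}d(S[0..n-1])=\infty$. -}

module Defs where

import Algebra.Definitions.RawSemiring
open import Data.Bool.Base using (Bool; true; false)
open import Data.Integer.Base using (+_)
open import Data.List.Base using (List; []; _∷_; _∷ʳ_; length; map; foldr; applyUpTo)
open import Data.List.Relation.Binary.Prefix.Heterogeneous using (Prefix)
open import Data.List.Relation.Unary.All using (All)
open import Data.List.Relation.Unary.Unique.Propositional using (Unique)
open import Data.Nat.Base as ℕ using (ℕ; zero; suc)
import Data.Nat.Properties as ℕ
open import Data.Product.Base using (Σ; Σ-syntax; ∃; ∃-syntax; _×_; _,_; proj₁)
open import Data.Rational.Base as ℚ using (ℚ; 0ℚ; 1ℚ; ½)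
import Data.Rational.Properties as ℚ
open import Data.Sum.Base using (_⊎_; inj₁; inj₂)
open import Level using (Level; 0ℓ; _⊔_) renaming (suc to lsuc)
open import Relation.Binary.PropositionalEquality using (_≡_; subst; sym)
open import Relation.Nullary using (¬_)
open import Relation.Unary using (Pred; _∈_; _⊆_; ∅; U; ⋃)

private
  variable
    a ℓ ℓ′ : Level
    I : Set a

  module ℚ^ = Algebra.Definitions.RawSemiring ℚ.+-*-rawSemiring

------------------------------------------------------------------------
-- Extended nonnegative reals
--
-- x ∈ [0,∞] is represented by its lower Dedekind cut {q ∈ ℚ | q < x}.
-- Under excluded middle these are exactly the classical extended
-- nonnegative reals, ∞ being the cut that contains every rational.

record ℝ≥0∞ (ℓ : Level) : Set (lsuc ℓ) where
  field
    below    : Pred ℚ ℓ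
    negative : ∀ {q} → q ℚ.< 0ℚ → below q
    lower    : ∀ {p q} → p ℚ.≤ q → below q → below p
    rounded  : ∀ {p} → below p → ∃[ q ] p ℚ.< q × below q

open ℝ≥0∞ public

infix 4 _≤_ _≈_

_≤_ : ℝ≥0∞ ℓ → ℝ≥0∞ ℓ′ → Set _
x ≤ y = below x ⊆ below y

_≈_ : ℝ≥0∞ ℓ → ℝ≥0∞ ℓ′ → Set _
x ≈ y = x ≤ y × y ≤ x

-- The supremum in [0,∞] of a set of rationals together with 0.

⋁ : Pred ℚ ℓ → ℝ≥0∞ ℓ
⋁ B .below q = q ℚ.< 0ℚ ⊎ (∃[ b ] b ∈ B × q ℚ.< b)
⋁ B .negative = inj₁
⋁ B .lower p≤q (inj₁ q<0) = inj₁ (ℚ.≤-<-trans p≤q q<0)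
⋁ B .lower p≤q (inj₂ (b , b∈B , q<b)) = inj₂ (b , b∈B , ℚ.≤-<-trans p≤q q<b)
⋁ B .rounded (inj₁ p<0) with ℚ.<-dense p<0
... | q , p<q , q<0 = q , p<q , inj₁ q<0
⋁ B .rounded (inj₂ (b , b∈B , p<b)) with ℚ.<-dense p<b
... | q , p<q , q<b = q , p<q , inj₂ (b , b∈B , q<b)

0# 1# ∞ : ℝ≥0∞ 0ℓ
0# = ⋁ ∅
1# = ⋁ (_≡ 1ℚ)
∞  = ⋁ U

infixl 6 _+_
infixl 7 _*_
infixr 8 _^_

_+_ : ℝ≥0∞ ℓ → ℝ≥0∞ ℓ → ℝ≥0∞ ℓ
x + y = ⋁ λ r → ∃[ p ] ∃[ q ] below x p × below y q × r ≡ p ℚ.+ q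

-- With this definition 0# * ∞ ≈ 0#.

_*_ : ℝ≥0∞ ℓ → ℝ≥0∞ ℓ → ℝ≥0∞ ℓ
x * y = ⋁ λ r → ∃[ p ] ∃[ q ]
  0ℚ ℚ.≤ p × below x p × 0ℚ ℚ.≤ q × below y q × r ≡ p ℚ.* q

_^_ : ℝ≥0∞ 0ℓ → ℕ → ℝ≥0∞ 0ℓ
x ^ zero  = 1#
x ^ suc n = x * x ^ n

⨆ ⨅ : {I : Set a} → (I → ℝ≥0∞ ℓ) → ℝ≥0∞ (a ⊔ ℓ)
⨆ x = ⋁ λ q → ∃[ i ] below (x i) q
⨅ x = ⋁ λ q → ∀ i → below (x i) q

partialSum : (ℕ → ℝ≥0∞ ℓ) → ℕ → ℝ≥0∞ ℓ
partialSum x zero    = x 0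
partialSum x (suc n) = partialSum x n + x (suc n)

series : (ℕ → ℝ≥0∞ ℓ) → ℝ≥0∞ ℓ
series x = ⨆ (partialSum x)

liminf limsup : (ℕ → ℝ≥0∞ ℓ) → ℝ≥0∞ ℓ
liminf x = ⨆ λ n → ⨅ λ k → x (n ℕ.+ k)
limsup x = ⨅ λ n → ⨆ λ k → x (n ℕ.+ k)

-- The limit of a sequence that has one.  It is only applied to antitone
-- sequences, which converge by antitone⇒convergent.

lim : (ℕ → ℝ≥0∞ ℓ) → ℝ≥0∞ ℓ
lim = liminf

liminf≤limsup : (x : ℕ → ℝ≥0∞ ℓ) → liminf x ≤ limsup x
liminf≤limsup x (inj₁ q<0) = inj₁ q<0
liminf≤limsup x (inj₂ (b , (n , inj₁ b<0) , q<b)) = inj₁ (ℚ.<-trans q<b b<0)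
liminf≤limsup x (inj₂ (b , (n , inj₂ (c , c<x , b<c)) , q<b)) =
  inj₂ (b , (λ m → inj₂ (c , (n , subst (λ k → below (x k) c) (ℕ.+-comm n m) (c<x m)) , b<c)) , q<b)

antitone⇒convergent : (x : ℕ → ℝ≥0∞ ℓ) → (∀ {m n} → m ℕ.≤ n → x n ≤ x m) →
                      limsup x ≈ liminf x
antitone⇒convergent x anti = to , liminf≤limsup x
  where
  below-⨆ : ∀ {n q} → below (⨆ λ k → x (n ℕ.+ k)) q → below (x n) q
  below-⨆ {n} (inj₁ q<0) = negative (x n) q<0
  below-⨆ {n} (inj₂ (b , (k , b<x) , q<b)) =
    lower (x n) (ℚ.<⇒≤ q<b) (anti (ℕ.m≤m+n n k) b<x)

  to : limsup x ≤ liminf x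
  to (inj₁ q<0) = inj₁ q<0
  to (inj₂ (b , b<x , q<b)) with ℚ.<-dense q<b
  ... | c , q<c , c<b =
    inj₂ (c , (0 , inj₂ (b , (λ n → below-⨆ (b<x n)) , c<b)) , q<c)

-- A nonnegative real is an extended one different from ∞.

record ℝ≥0 : Set₁ where
  field
    value  : ℝ≥0∞ 0ℓ
    finite : ∃[ q ] ¬ below value q

open ℝ≥0 public

inf : Pred ℝ≥0 ℓ → ℝ≥0∞ (lsuc 0ℓ ⊔ ℓ)
inf P = ⨅ λ ((s , _) : ∃ P) → value s

-- 2⁻ˢ is the supremum of the rationals b with b ≤ 2^(-m/n) for some
-- rational m/n ≥ s; the condition on b is written bⁿ ≤ 2⁻ᵐ, and the
-- code uses n + 1 for n.

2^- : ℝ≥0 → ℝ≥0∞ 0ℓ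
2^- s = ⋁ λ b → 0ℚ ℚ.≤ b ×
  (∃[ m ] ∃[ n ] ¬ below (value s) (+ m ℚ./ suc n) × b ℚ^.^ suc n ℚ.≤ ½ ℚ^.^ m)

------------------------------------------------------------------------
-- Strings and sequences

String : Set
String = List Bool

Cantor : Set
Cantor = ℕ → Bool

infixl 9 _↾_

_↾_ : Cantor → ℕ → String
S ↾ n = applyUpTo S n

Cylinder : String → Pred Cantor 0ℓ
Cylinder w S = S ↾ length w ≡ w

IsPrefixSet : Pred String 0ℓ → Set
IsPrefixSet A = ∀ {u v} → u ∈ A → v ∈ A → Prefix _≡_ u v → u ≡ v

------------------------------------------------------------------------
-- Packing dimension

-- The sum over A of nonnegative terms, as the supremum of its finite
-- subsums.

∑ : Pred String 0ℓ → (String → ℝ≥0∞ 0ℓ) → ℝ≥0∞ 0ℓ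
∑ A f = ⨆ λ ((ws , _) : ∃[ ws ] Unique ws × All A ws) → foldr _+_ 0# (map f ws)

record 𝓑 (k : ℕ) (X : Pred Cantor 0ℓ) (A : Pred String 0ℓ) : Set where
  field
    prefixSet : IsPrefixSet A
    long      : ∀ {w} → w ∈ A → k ℕ.≤ length w
    meets     : ∀ {w} → w ∈ A → ∃[ S ] S ∈ Cylinder w × S ∈ X

open 𝓑 public

-- The terms 2^(-s|w|) are written (2⁻ˢ)^|w|.

Pₖ : ℕ → ℝ≥0 → Pred Cantor 0ℓ → ℝ≥0∞ (lsuc 0ℓ)
Pₖ k s X = ⨆ λ ((A , _) : ∃ (𝓑 k X)) → ∑ A λ w → 2^- s ^ length w

Pₖ-antitone : ∀ s X {k l} → k ℕ.≤ l → Pₖ l s X ≤ Pₖ k s X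
Pₖ-antitone s X k≤l (inj₁ q<0) = inj₁ q<0
Pₖ-antitone s X k≤l (inj₂ (b , ((A , A∈𝓑) , b<∑) , q<b)) =
  inj₂ (b , ((A , A∈𝓑′) , b<∑) , q<b)
  where
  A∈𝓑′ = record
    { prefixSet = prefixSet A∈𝓑
    ; long      = λ w∈A → ℕ.≤-trans k≤l (long A∈𝓑 w∈A)
    ; meets     = meets A∈𝓑
    }

P∞ : ℝ≥0 → Pred Cantor 0ℓ → ℝ≥0∞ (lsuc 0ℓ)
P∞ s X = lim λ k → Pₖ k s X

P : ℝ≥0 → Pred Cantor 0ℓ → ℝ≥0∞ (lsuc 0ℓ)
P s X = ⨅ λ ((Xs , _) : Σ[ Xs ∈ (ℕ → Pred Cantor 0ℓ) ] X ⊆ ⋃ ℕ Xs) →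
  series λ i → P∞ s (Xs i)

dimP : Pred Cantor 0ℓ → ℝ≥0∞ (lsuc 0ℓ)
dimP X = inf λ s → P s X ≈ 0#

------------------------------------------------------------------------
-- Gales

IsGale : ℝ≥0 → (String → ℝ≥0) → Set
IsGale s d = ∀ w →
  value (d w) ≈ 2^- s * (value (d (w ∷ʳ false)) + value (d (w ∷ʳ true)))

SucceedsStronglyOn : (String → ℝ≥0) → Cantor → Set
SucceedsStronglyOn d S = liminf (λ n → value (d (S ↾ n))) ≈ ∞

𝓖ˢᵗʳ : Pred Cantor 0ℓ → Pred ℝ≥0 (lsuc 0ℓ)
𝓖ˢᵗʳ X s = ∃[ d ] IsGale s d × (∀ {S} → S ∈ X → SucceedsStronglyOn d S)

{-# OPTIONS --safe #-}
module Submission where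

-- If s is at most q and q < q′, there are an exponent t ≤ q′ and rationals r < 1 and
-- σ ≤ 2⁻ˢ such that 2⁻ᵗ is the rational r²σ; it suffices to pass from s to such a t.
--
-- Gales to packing: if the s-gale d succeeds strongly on X, then X is covered by the sets
-- X_i of all S with d(S[0..n-1]) > 1 for all n ≥ i.  Kraft's inequality for d bounds
-- ∑ σ^|w| over a prefix set of strings that meet X_i and have length at least k ≥ i by
-- d(λ), so ∑ 2^(-t|w|) ≤ rᵏ d(λ), which tends to 0.
--
-- Packing to gales: if Pˢ(X) = 0, then X is covered by sets X_i such that, for n ≥ k_i,
-- the set A_{i,n} of strings of length n that meet X_i is a prefix set with
-- ∑ σⁿ ≤ 2.  The t-gale that is 1 at v ∈ A_{i,n} has value (r²σ)ⁿ at the root, so the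
-- weighted sum of all of them, with weights rⁱ r⁻ⁿ for i ≤ n, is at most ∑ 2 rⁱ rⁿ < ∞ at
-- the root, and its value at S[0..n-1] is at least rⁱ r⁻ⁿ for S ∈ X_i and large n.

import Algebra.Properties.CommutativeSemiring.Exp as Exp
open import Algebra.Bundles using (CommutativeRing)
open import Axiom.ExcludedMiddle using (ExcludedMiddle)
open import Data.Bool.Base using (Bool; true; false)
import Data.Integer.Base as ℤ
import Data.Integer.Properties as ℤ
open import Data.List.Base using (List; []; _∷_; _∷ʳ_; _++_; length; map; foldr; filter)
import Data.List.Properties as List
open import Data.List.Membership.Propositional using () renaming (_∈_ to _∈ₗ_)
import Data.List.Membership.Propositional.Properties as ∈ₗ
open import Data.List.Relation.Binary.Prefix.Heterogeneous using (Prefix; []; _∷_)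
open import Data.List.Relation.Unary.All as All using (All; []; _∷_)
import Data.List.Relation.Unary.All.Properties as All
open import Data.List.Relation.Unary.AllPairs using (AllPairs; []; _∷_)
open import Data.List.Relation.Unary.Any using (here; there)
open import Data.List.Relation.Unary.Unique.Propositional using (Unique)
import Data.List.Relation.Unary.Unique.Propositional.Properties as Unique
open import Data.Nat.Base as ℕ using (ℕ; zero; suc)
import Data.Nat.Properties as ℕ
open import Data.Product.Base using (Σ-syntax; ∃-syntax; _×_; _,_; proj₁; proj₂)
open import Data.Rational.Base as ℚ using (ℚ; 0ℚ; 1ℚ; ½; mkℚ)
import Data.Rational.Properties as ℚ
open import Data.Rational.Solver using (module +-*-Solver)
import Data.Rational.Unnormalised.Base as ℚᵘ
import Data.Rational.Unnormalised.Properties as ℚᵘ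
open import Data.Sum.Base using (_⊎_; inj₁; inj₂)
open import Data.Unit.Base using (tt)
open import Function.Base using (_∘_)
open import Level using (Level; 0ℓ; Lift; lift) renaming (suc to lsuc)
open import Relation.Binary.Core using (Rel)
open import Relation.Binary.PropositionalEquality
open import Relation.Nullary using (¬_; Dec; yes; no; contradiction)
open import Relation.Nullary.Decidable using (map′; decidable-stable)
open import Relation.Unary using (Pred; _∈_; _⊆_; ⋃)
open import Defs

module ℚ^ = Exp (CommutativeRing.commutativeSemiring ℚ.+-*-commutativeRing)
open +-*-Solver using (solve; _:+_; _:*_; _:=_; con)

private variable
  p p′ q q′ u v z x y δ ε : ℚ
  k m n : ℕ
  ℓ ℓ′ : Level

-- Rational arithmetic

*-monoˡ : 0ℚ ℚ.≤ z → p ℚ.≤ q → z ℚ.* p ℚ.≤ z ℚ.* q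
*-monoˡ {z} 0≤z = ℚ.*-monoˡ-≤-nonNeg z {{ℚ.nonNegative 0≤z}}

*-monoʳ : 0ℚ ℚ.≤ z → p ℚ.≤ q → p ℚ.* z ℚ.≤ q ℚ.* z
*-monoʳ {z} 0≤z = ℚ.*-monoʳ-≤-nonNeg z {{ℚ.nonNegative 0≤z}}

*-mono : 0ℚ ℚ.≤ p → 0ℚ ℚ.≤ q′ → p ℚ.≤ p′ → q ℚ.≤ q′ → p ℚ.* q ℚ.≤ p′ ℚ.* q′
*-mono 0≤p 0≤q′ p≤p′ q≤q′ = ℚ.≤-trans (*-monoˡ 0≤p q≤q′) (*-monoʳ 0≤q′ p≤p′)

*-monoˡ-< : 0ℚ ℚ.< z → p ℚ.< q → z ℚ.* p ℚ.< z ℚ.* q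
*-monoˡ-< {z} 0<z = ℚ.*-monoʳ-<-pos z {{ℚ.positive 0<z}}

*-cancelˡ : 0ℚ ℚ.< z → z ℚ.* p ℚ.≤ z ℚ.* q → p ℚ.≤ q
*-cancelˡ {z} 0<z = ℚ.*-cancelˡ-≤-pos z {{ℚ.positive 0<z}}

*-cancelʳ : 0ℚ ℚ.< z → p ℚ.* z ℚ.≤ q ℚ.* z → p ℚ.≤ q
*-cancelʳ {z} 0<z = ℚ.*-cancelʳ-≤-pos z {{ℚ.positive 0<z}}

*-nonNeg : 0ℚ ℚ.≤ p → 0ℚ ℚ.≤ q → 0ℚ ℚ.≤ p ℚ.* q
*-nonNeg {p} 0≤p 0≤q = subst₂ ℚ._≤_ (ℚ.*-zeroʳ p) refl (*-monoˡ 0≤p 0≤q)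

*-pos : 0ℚ ℚ.< p → 0ℚ ℚ.< q → 0ℚ ℚ.< p ℚ.* q
*-pos {p} 0<p 0<q = subst₂ ℚ._<_ (ℚ.*-zeroʳ p) refl (*-monoˡ-< 0<p 0<q)

+-nonNeg : 0ℚ ℚ.≤ p → 0ℚ ℚ.≤ q → 0ℚ ℚ.≤ p ℚ.+ q
+-nonNeg = ℚ.+-mono-≤

p≤p+q : 0ℚ ℚ.≤ q → p ℚ.≤ p ℚ.+ q
p≤p+q {p = p} 0≤q = subst₂ ℚ._≤_ (ℚ.+-identityʳ p) refl (ℚ.+-monoʳ-≤ p 0≤q)

p≤q+p : 0ℚ ℚ.≤ q → p ℚ.≤ q ℚ.+ p
p≤q+p {p = p} 0≤q = subst₂ ℚ._≤_ (ℚ.+-identityˡ p) refl (ℚ.+-monoˡ-≤ p 0≤q)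

p<p+1 : p ℚ.< p ℚ.+ 1ℚ
p<p+1 {p} = subst₂ ℚ._<_ (ℚ.+-identityʳ p) refl (ℚ.+-monoʳ-< p (ℚ.positive⁻¹ 1ℚ))

0≤1 : 0ℚ ℚ.≤ 1ℚ
0≤1 = ℚ.nonNegative⁻¹ 1ℚ

0<1 : 0ℚ ℚ.< 1ℚ
0<1 = ℚ.positive⁻¹ 1ℚ

0<½ : 0ℚ ℚ.< ½
0<½ = ℚ.positive⁻¹ ½

0≤½ : 0ℚ ℚ.≤ ½
0≤½ = ℚ.<⇒≤ 0<½

½<1 : ½ ℚ.< 1ℚ
½<1 = ℚ.*<* (ℤ.+<+ (ℕ.s≤s (ℕ.s≤s ℕ.z≤n)))

½≤1 : ½ ℚ.≤ 1ℚ
½≤1 = ℚ.<⇒≤ ½<1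

2ℚ : ℚ
2ℚ = 1ℚ ℚ.+ 1ℚ

p<q⇒0<q-p : p ℚ.< q → 0ℚ ℚ.< q ℚ.- p
p<q⇒0<q-p {p} p<q = subst₂ ℚ._<_ (ℚ.+-inverseʳ p) refl (ℚ.+-monoˡ-< (ℚ.- p) p<q)

p+[q-p]≡q : ∀ p q → p ℚ.+ (q ℚ.- p) ≡ q
p+[q-p]≡q p q = begin
  p ℚ.+ (q ℚ.- p)     ≡⟨ ℚ.+-comm p _ ⟩
  q ℚ.- p ℚ.+ p       ≡⟨ ℚ.+-assoc q (ℚ.- p) p ⟩
  q ℚ.+ (ℚ.- p ℚ.+ p) ≡⟨ cong (q ℚ.+_) (ℚ.+-inverseˡ p) ⟩
  q ℚ.+ 0ℚ            ≡⟨ ℚ.+-identityʳ q ⟩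
  q                   ∎
  where open ≡-Reasoning

-- Powers of rationals.

^-nonNeg : ∀ n → 0ℚ ℚ.≤ x → 0ℚ ℚ.≤ x ℚ^.^ n
^-nonNeg zero    0≤x = 0≤1
^-nonNeg (suc n) 0≤x = *-nonNeg 0≤x (^-nonNeg n 0≤x)

^-pos : ∀ n → 0ℚ ℚ.< x → 0ℚ ℚ.< x ℚ^.^ n
^-pos zero    0<x = 0<1
^-pos (suc n) 0<x = *-pos 0<x (^-pos n 0<x)

^-mono : ∀ n → 0ℚ ℚ.≤ x → x ℚ.≤ y → x ℚ^.^ n ℚ.≤ y ℚ^.^ n
^-mono zero    0≤x x≤y = ℚ.≤-refl
^-mono (suc n) 0≤x x≤y =
  *-mono 0≤x (^-nonNeg n (ℚ.≤-trans 0≤x x≤y)) x≤y (^-mono n 0≤x x≤y)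

^-mono-< : ∀ n → 0ℚ ℚ.≤ x → x ℚ.< y → x ℚ^.^ suc n ℚ.< y ℚ^.^ suc n
^-mono-< {x} {y} n 0≤x x<y =
  ℚ.≤-<-trans (*-monoˡ 0≤x (^-mono n 0≤x (ℚ.<⇒≤ x<y)))
    (ℚ.*-monoˡ-<-pos (y ℚ^.^ n) {{ℚ.positive (^-pos n (ℚ.≤-<-trans 0≤x x<y))}} x<y)

^-cancel : ∀ n → 0ℚ ℚ.≤ y → x ℚ^.^ suc n ℚ.≤ y ℚ^.^ suc n → x ℚ.≤ y
^-cancel n 0≤y xⁿ≤yⁿ =
  ℚ.≮⇒≥ λ y<x → ℚ.<-irrefl refl (ℚ.<-≤-trans (^-mono-< n 0≤y y<x) xⁿ≤yⁿ)

1^n≡1 : ∀ n → 1ℚ ℚ^.^ n ≡ 1ℚ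
1^n≡1 zero    = refl
1^n≡1 (suc n) = trans (ℚ.*-identityˡ _) (1^n≡1 n)

^-antitone : 0ℚ ℚ.≤ x → x ℚ.≤ 1ℚ → m ℕ.≤ n → x ℚ^.^ n ℚ.≤ x ℚ^.^ m
^-antitone {x} {n = n} 0≤x x≤1 ℕ.z≤n =
  subst (x ℚ^.^ n ℚ.≤_) (1^n≡1 n) (^-mono n 0≤x x≤1)
^-antitone 0≤x x≤1 (ℕ.s≤s m≤n) = *-monoˡ 0≤x (^-antitone 0≤x x≤1 m≤n)

^-monoʳ : 1ℚ ℚ.≤ x → m ℕ.≤ n → x ℚ^.^ m ℚ.≤ x ℚ^.^ n
^-monoʳ {x} {n = n} 1≤x ℕ.z≤n =
  subst (ℚ._≤ x ℚ^.^ n) (1^n≡1 n) (^-mono n 0≤1 1≤x)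
^-monoʳ 1≤x (ℕ.s≤s m≤n) = *-monoˡ (ℚ.≤-trans 0≤1 1≤x) (^-monoʳ 1≤x m≤n)

^-comm : ∀ x m n → (x ℚ^.^ m) ℚ^.^ n ≡ (x ℚ^.^ n) ℚ^.^ m
^-comm x m n = begin
  (x ℚ^.^ m) ℚ^.^ n ≡⟨ ℚ^.^-assocʳ x m n ⟩
  x ℚ^.^ (m ℕ.* n)  ≡⟨ cong (x ℚ^.^_) (ℕ.*-comm m n) ⟩
  x ℚ^.^ (n ℕ.* m)  ≡⟨ ℚ^.^-assocʳ x n m ⟨
  (x ℚ^.^ n) ℚ^.^ m ∎
  where open ≡-Reasoning

-- Archimedean property, Bernoulli's inequality and the growth of powers.

fromℕ : ℕ → ℚ
fromℕ zero    = 0ℚ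
fromℕ (suc n) = 1ℚ ℚ.+ fromℕ n

fromℕ-nonNeg : ∀ n → 0ℚ ℚ.≤ fromℕ n
fromℕ-nonNeg zero    = ℚ.≤-refl
fromℕ-nonNeg (suc n) = +-nonNeg 0≤1 (fromℕ-nonNeg n)

toℚᵘ-fromℕ : ∀ n → ℚ.toℚᵘ (fromℕ n) ℚᵘ.≃ ℚᵘ.mkℚᵘ (ℤ.+ n) 0
toℚᵘ-fromℕ zero    = ℚᵘ.≃-refl
toℚᵘ-fromℕ (suc n) = begin
  ℚ.toℚᵘ (1ℚ ℚ.+ fromℕ n)                 ≈⟨ ℚ.toℚᵘ-homo-+ 1ℚ (fromℕ n) ⟩
  ℚᵘ.1ℚᵘ ℚᵘ.+ ℚ.toℚᵘ (fromℕ n)            ≈⟨ ℚᵘ.+-congʳ ℚᵘ.1ℚᵘ (toℚᵘ-fromℕ n) ⟩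
  ℚᵘ.1ℚᵘ ℚᵘ.+ ℚᵘ.mkℚᵘ (ℤ.+ n) 0
    ≈⟨ ℚᵘ.*≡* (cong (λ k → (ℤ.+ 1 ℤ.+ k) ℤ.* ℤ.+ 1) (ℤ.*-identityʳ (ℤ.+ n))) ⟩
  ℚᵘ.mkℚᵘ (ℤ.+ suc n) 0                   ∎
  where open ℚᵘ.≃-Reasoning

-- The denominator is at least 1, so the absolute value of the numerator is a bound.
p≤fromℕ : ∀ p → ∃[ n ] p ℚ.≤ fromℕ n
p≤fromℕ p@(mkℚ a d _) = ℤ.∣ a ∣ , ℚ.toℚᵘ-cancel-≤ (begin
  ℚ.toℚᵘ p                    ≤⟨ ℚᵘ.*≤* le ⟩
  ℚᵘ.mkℚᵘ (ℤ.+ ℤ.∣ a ∣) 0     ≃⟨ toℚᵘ-fromℕ ℤ.∣ a ∣ ⟨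
  ℚ.toℚᵘ (fromℕ ℤ.∣ a ∣)      ∎)
  where
  open ℚᵘ.≤-Reasoning
  le′ : ∀ a → a ℤ.* ℤ.+ 1 ℤ.≤ ℤ.+ ℤ.∣ a ∣ ℤ.* ℤ.+ suc d
  le′ (ℤ.+ n)      = ℤ.*-monoˡ-≤-nonNeg (ℤ.+ n) (ℤ.+≤+ (ℕ.s≤s ℕ.z≤n))
  le′ (ℤ.-[1+ n ]) = ℤ.-≤+
  le = le′ a

archimedean : 0ℚ ℚ.< p → ∀ q → ∃[ n ] q ℚ.≤ fromℕ n ℚ.* p
archimedean {p} 0<p q with p≤fromℕ (q ℚ.* (ℚ.1/ p) {{ℚ.>-nonZero 0<p}})
... | n , q/p≤n = n , (begin
  q                      ≡⟨ ℚ.*-identityʳ q ⟨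
  q ℚ.* 1ℚ               ≡⟨ cong (q ℚ.*_) (ℚ.*-inverseˡ p) ⟨
  q ℚ.* (ℚ.1/ p ℚ.* p)   ≡⟨ ℚ.*-assoc q (ℚ.1/ p) p ⟨
  q ℚ.* ℚ.1/ p ℚ.* p     ≤⟨ *-monoʳ (ℚ.<⇒≤ 0<p) q/p≤n ⟩
  fromℕ n ℚ.* p          ∎)
  where
  open ℚ.≤-Reasoning
  instance _ = ℚ.>-nonZero 0<p

-- Bernoulli's inequality ((x + δ)/x)ⁿ ≥ 1 + n δ/x, without the divisions.

bernoulli : ∀ n → 0ℚ ℚ.≤ x → 0ℚ ℚ.≤ δ →
            x ℚ^.^ n ℚ.* (x ℚ.+ fromℕ n ℚ.* δ) ℚ.≤ (x ℚ.+ δ) ℚ^.^ n ℚ.* x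
bernoulli {x} {δ} zero 0≤x 0≤δ = ℚ.≤-reflexive
  (solve 2 (λ x δ → con 1ℚ :* (x :+ con 0ℚ :* δ) := con 1ℚ :* x) refl x δ)
bernoulli {x} {δ} (suc n) 0≤x 0≤δ = begin
  x ℚ.* xⁿ ℚ.* (x ℚ.+ (1ℚ ℚ.+ ν) ℚ.* δ)
    ≤⟨ p≤p+q (*-nonNeg (*-nonNeg (^-nonNeg n 0≤x) (fromℕ-nonNeg n)) (*-nonNeg 0≤δ 0≤δ)) ⟩
  x ℚ.* xⁿ ℚ.* (x ℚ.+ (1ℚ ℚ.+ ν) ℚ.* δ) ℚ.+ xⁿ ℚ.* ν ℚ.* (δ ℚ.* δ)
    ≡⟨ solve 4 (λ x δ xⁿ ν →
         x :* xⁿ :* (x :+ (con 1ℚ :+ ν) :* δ) :+ xⁿ :* ν :* (δ :* δ) :=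
         (x :+ δ) :* (xⁿ :* (x :+ ν :* δ))) refl x δ xⁿ ν ⟩
  (x ℚ.+ δ) ℚ.* (xⁿ ℚ.* (x ℚ.+ ν ℚ.* δ))
    ≤⟨ *-monoˡ (+-nonNeg 0≤x 0≤δ) (bernoulli n 0≤x 0≤δ) ⟩
  (x ℚ.+ δ) ℚ.* ((x ℚ.+ δ) ℚ^.^ n ℚ.* x)
    ≡⟨ ℚ.*-assoc (x ℚ.+ δ) ((x ℚ.+ δ) ℚ^.^ n) x ⟨
  (x ℚ.+ δ) ℚ.* (x ℚ.+ δ) ℚ^.^ n ℚ.* x ∎
  where
  open ℚ.≤-Reasoning
  xⁿ = x ℚ^.^ n
  ν = fromℕ n

-- By Bernoulli's inequality, ((x + δ)/x)^(n+1) is at least 1 + (n+1)δ/x, which exceeds 1/ε once x ≤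
-- nεδ.
powers-separate-+ : 0ℚ ℚ.< x → 0ℚ ℚ.< δ → 0ℚ ℚ.< ε →
                    ∃[ n ] x ℚ^.^ suc n ℚ.≤ ε ℚ.* (x ℚ.+ δ) ℚ^.^ suc n
powers-separate-+ {x} {δ} {ε} 0<x 0<δ 0<ε = separate (archimedean (*-pos 0<ε 0<δ) x)
  where
  open ℚ.≤-Reasoning
  0≤x = ℚ.<⇒≤ 0<x
  0≤δ = ℚ.<⇒≤ 0<δ

  identity : ∀ x δ z ν ε → z ℚ.* (ν ℚ.* (ε ℚ.* δ)) ℚ.+ z ℚ.* (ε ℚ.* (x ℚ.+ δ)) ≡
                           ε ℚ.* (z ℚ.* (x ℚ.+ (1ℚ ℚ.+ ν) ℚ.* δ))
  identity = solve 5 (λ x δ z ν ε → z :* (ν :* (ε :* δ)) :+ z :* (ε :* (x :+ δ)) :=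
                                    ε :* (z :* (x :+ (con 1ℚ :+ ν) :* δ))) refl

  bound : ∀ z ν → 0ℚ ℚ.≤ z → x ℚ.≤ ν ℚ.* (ε ℚ.* δ) →
          z ℚ.* x ℚ.≤ ε ℚ.* (z ℚ.* (x ℚ.+ (1ℚ ℚ.+ ν) ℚ.* δ))
  bound z ν 0≤z x≤νεδ = begin
    z ℚ.* x
      ≤⟨ *-monoˡ 0≤z x≤νεδ ⟩
    z ℚ.* (ν ℚ.* (ε ℚ.* δ))
      ≤⟨ p≤p+q (*-nonNeg 0≤z (*-nonNeg (ℚ.<⇒≤ 0<ε) (+-nonNeg 0≤x 0≤δ))) ⟩
    z ℚ.* (ν ℚ.* (ε ℚ.* δ)) ℚ.+ z ℚ.* (ε ℚ.* (x ℚ.+ δ))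
      ≡⟨ identity x δ z ν ε ⟩
    ε ℚ.* (z ℚ.* (x ℚ.+ (1ℚ ℚ.+ ν) ℚ.* δ)) ∎

  separate : (∃[ n ] x ℚ.≤ fromℕ n ℚ.* (ε ℚ.* δ)) →
             ∃[ n ] x ℚ^.^ suc n ℚ.≤ ε ℚ.* (x ℚ.+ δ) ℚ^.^ suc n
  separate (n , x≤nεδ) = n , *-cancelʳ {x} 0<x (begin
    x ℚ^.^ suc n ℚ.* x
      ≤⟨ bound (x ℚ^.^ suc n) (fromℕ n) (^-nonNeg (suc n) 0≤x) x≤nεδ ⟩
    ε ℚ.* (x ℚ^.^ suc n ℚ.* (x ℚ.+ fromℕ (suc n) ℚ.* δ))
      ≤⟨ *-monoˡ (ℚ.<⇒≤ 0<ε) (bernoulli (suc n) 0≤x 0≤δ) ⟩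
    ε ℚ.* ((x ℚ.+ δ) ℚ^.^ suc n ℚ.* x)
      ≡⟨ ℚ.*-assoc ε ((x ℚ.+ δ) ℚ^.^ suc n) x ⟨
    ε ℚ.* (x ℚ.+ δ) ℚ^.^ suc n ℚ.* x ∎)

powers-separate : 0ℚ ℚ.< x → x ℚ.< y → 0ℚ ℚ.< ε →
                  ∃[ n ] x ℚ^.^ suc n ℚ.≤ ε ℚ.* y ℚ^.^ suc n
powers-separate {x} {y} {ε} 0<x x<y 0<ε =
  subst (λ y → ∃[ n ] x ℚ^.^ suc n ℚ.≤ ε ℚ.* y ℚ^.^ suc n) (p+[q-p]≡q x y)
    (powers-separate-+ 0<x (p<q⇒0<q-p x<y) 0<ε)

powers-vanish : 0ℚ ℚ.< x → x ℚ.< 1ℚ → 0ℚ ℚ.< ε → ∃[ n ] x ℚ^.^ n ℚ.≤ ε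
powers-vanish {x} {ε} 0<x x<1 0<ε =
  let n , xⁿ≤ε1ⁿ = powers-separate 0<x x<1 0<ε
  in suc n , subst (x ℚ^.^ suc n ℚ.≤_)
       (trans (cong (ε ℚ.*_) (1^n≡1 (suc n))) (ℚ.*-identityʳ ε)) xⁿ≤ε1ⁿ

powers-unbounded : 0ℚ ℚ.< δ → ∀ q → ∃[ n ] q ℚ.≤ (1ℚ ℚ.+ δ) ℚ^.^ n
powers-unbounded {δ} 0<δ q = let n , q≤nδ = archimedean 0<δ q in n , (begin
  q                                               ≤⟨ q≤nδ ⟩
  fromℕ n ℚ.* δ                                   ≤⟨ p≤q+p 0≤1 ⟩
  1ℚ ℚ.+ fromℕ n ℚ.* δ                            ≡⟨ ℚ.*-identityˡ _ ⟨
  1ℚ ℚ.* (1ℚ ℚ.+ fromℕ n ℚ.* δ)                   ≡⟨ cong (ℚ._* (1ℚ ℚ.+ fromℕ n ℚ.* δ)) (1^n≡1 n) ⟨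
  1ℚ ℚ^.^ n ℚ.* (1ℚ ℚ.+ fromℕ n ℚ.* δ)            ≤⟨ bernoulli n 0≤1 (ℚ.<⇒≤ 0<δ) ⟩
  (1ℚ ℚ.+ δ) ℚ^.^ n ℚ.* 1ℚ                        ≡⟨ ℚ.*-identityʳ _ ⟩
  (1ℚ ℚ.+ δ) ℚ^.^ n                               ∎)
  where open ℚ.≤-Reasoning

-- Powers of a rational close to 1.

bernoulli-≤1 : 0ℚ ℚ.≤ x → 0ℚ ℚ.≤ δ → x ℚ.+ δ ≡ 1ℚ → ∀ n →
               1ℚ ℚ.≤ x ℚ^.^ n ℚ.+ fromℕ n ℚ.* δ
bernoulli-≤1 {x} {δ} 0≤x 0≤δ x+δ≡1 zero =
  ℚ.≤-reflexive (sym (trans (cong (1ℚ ℚ.+_) (ℚ.*-zeroˡ δ)) (ℚ.+-identityʳ 1ℚ)))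
bernoulli-≤1 {x} {δ} 0≤x 0≤δ x+δ≡1 (suc n) = begin
  1ℚ                                       ≡⟨ x+δ≡1 ⟨
  x ℚ.+ δ                                  ≡⟨ cong (ℚ._+ δ) (ℚ.*-identityʳ x) ⟨
  x ℚ.* 1ℚ ℚ.+ δ
    ≤⟨ ℚ.+-monoˡ-≤ δ (*-monoˡ 0≤x (bernoulli-≤1 0≤x 0≤δ x+δ≡1 n)) ⟩
  x ℚ.* (x ℚ^.^ n ℚ.+ ν ℚ.* δ) ℚ.+ δ
    ≡⟨ cong (ℚ._+ δ) (ℚ.*-distribˡ-+ x (x ℚ^.^ n) (ν ℚ.* δ)) ⟩
  xⁿ⁺¹ ℚ.+ x ℚ.* (ν ℚ.* δ) ℚ.+ δ
    ≤⟨ ℚ.+-monoˡ-≤ δ (ℚ.+-monoʳ-≤ xⁿ⁺¹ (*-monoʳ (*-nonNeg (fromℕ-nonNeg n) 0≤δ) x≤1)) ⟩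
  xⁿ⁺¹ ℚ.+ 1ℚ ℚ.* (ν ℚ.* δ) ℚ.+ δ
    ≡⟨ identity xⁿ⁺¹ ν δ ⟩
  xⁿ⁺¹ ℚ.+ (1ℚ ℚ.+ ν) ℚ.* δ               ∎
  where
  open ℚ.≤-Reasoning
  ν = fromℕ n
  xⁿ⁺¹ = x ℚ^.^ suc n
  x≤1 : x ℚ.≤ 1ℚ
  x≤1 = subst (x ℚ.≤_) x+δ≡1 (p≤p+q 0≤δ)
  identity : ∀ z ν δ → z ℚ.+ 1ℚ ℚ.* (ν ℚ.* δ) ℚ.+ δ ≡ z ℚ.+ (1ℚ ℚ.+ ν) ℚ.* δ
  identity = solve 3 (λ z ν δ → z :+ con 1ℚ :* (ν :* δ) :+ δ := z :+ (con 1ℚ :+ ν) :* δ) refl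

-- The witness is 1 - η with η = ½/(n+1): by `bernoulli-≤1` its n-th power is at least 1 - nη ≥ ½.
near-one : ∀ n → ∃[ x ] 0ℚ ℚ.< x × x ℚ.< 1ℚ × ½ ℚ.≤ x ℚ^.^ n
near-one n = w , 0<w , w<1 , (begin
  ½                                      ≡⟨ p+[q-p]≡q ½ ½ ⟨
  ½ ℚ.+ (½ ℚ.- ½)                        ≡⟨ ℚ.+-assoc ½ ½ (ℚ.- ½) ⟨
  1ℚ ℚ.- ½
    ≤⟨ ℚ.+-monoˡ-≤ (ℚ.- ½) (bernoulli-≤1 (ℚ.<⇒≤ 0<w) 0≤η w+η≡1 n) ⟩
  w ℚ^.^ n ℚ.+ fromℕ n ℚ.* η ℚ.- ½       ≤⟨ ℚ.+-monoˡ-≤ (ℚ.- ½) (ℚ.+-monoʳ-≤ (w ℚ^.^ n) nη≤½) ⟩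
  w ℚ^.^ n ℚ.+ ½ ℚ.- ½                   ≡⟨ ℚ.+-assoc (w ℚ^.^ n) ½ (ℚ.- ½) ⟩
  w ℚ^.^ n ℚ.+ (½ ℚ.- ½)                 ≡⟨ ℚ.+-identityʳ _ ⟩
  w ℚ^.^ n                               ∎)
  where
  open ℚ.≤-Reasoning
  c = fromℕ (suc n)
  1≤c : 1ℚ ℚ.≤ c
  1≤c = p≤p+q (fromℕ-nonNeg n)
  0<c = ℚ.<-≤-trans 0<1 1≤c
  instance
    c-pos = ℚ.positive 0<c
    c≢0 = ℚ.pos⇒nonZero c
  η = ½ ℚ.* ℚ.1/ c
  0<η : 0ℚ ℚ.< η
  0<η = *-pos 0<½ (ℚ.positive⁻¹ (ℚ.1/ c) {{ℚ.1/pos⇒pos c}})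
  0≤η = ℚ.<⇒≤ 0<η
  cη≡½ : c ℚ.* η ≡ ½
  cη≡½ = begin-equality
    c ℚ.* (½ ℚ.* ℚ.1/ c)   ≡⟨ ℚ.*-comm c η ⟩
    ½ ℚ.* ℚ.1/ c ℚ.* c     ≡⟨ ℚ.*-assoc ½ (ℚ.1/ c) c ⟩
    ½ ℚ.* (ℚ.1/ c ℚ.* c)   ≡⟨ cong (½ ℚ.*_) (ℚ.*-inverseˡ c) ⟩
    ½ ℚ.* 1ℚ               ≡⟨ ℚ.*-identityʳ ½ ⟩
    ½ ∎
  nη≤½ : fromℕ n ℚ.* η ℚ.≤ ½
  nη≤½ = subst (fromℕ n ℚ.* η ℚ.≤_) cη≡½ (*-monoʳ 0≤η (p≤q+p {p = fromℕ n} 0≤1))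
  η<1 : η ℚ.< 1ℚ
  η<1 = ℚ.≤-<-trans
    (subst₂ ℚ._≤_ (ℚ.*-identityˡ η) cη≡½ (*-monoʳ 0≤η 1≤c)) ½<1
  w = 1ℚ ℚ.- η
  0<w = p<q⇒0<q-p η<1
  w+η≡1 : w ℚ.+ η ≡ 1ℚ
  w+η≡1 = trans (ℚ.+-comm w η) (p+[q-p]≡q η 1ℚ)
  w<1 : w ℚ.< 1ℚ
  w<1 = subst₂ ℚ._<_ (ℚ.+-identityʳ w) w+η≡1 (ℚ.+-monoʳ-< w 0<η)

-- The search walks down from `n` while the power stays at most `q`. Where it stops, the exponent is
-- 0 or the preceding power is at least `q`. So rounding `q` down to a power of `x` costs at most
-- one factor `x`.
power-between : 0ℚ ℚ.≤ x → x ℚ.≤ 1ℚ → q ℚ.≤ 1ℚ → 0ℚ ℚ.≤ q → ∀ n → x ℚ^.^ n ℚ.≤ q →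
                ∃[ j ] x ℚ^.^ j ℚ.≤ q × x ℚ.* q ℚ.≤ x ℚ^.^ j
power-between {x} 0≤x x≤1 q≤1 0≤q zero 1≤q =
  0 , 1≤q , ℚ.≤-trans (*-mono 0≤x 0≤1 x≤1 q≤1) (ℚ.≤-reflexive (ℚ.*-identityˡ 1ℚ))
power-between {x} {q} 0≤x x≤1 q≤1 0≤q (suc n) xⁿ⁺¹≤q = go (ℚ.≤-total (x ℚ^.^ n) q)
  where
  go : x ℚ^.^ n ℚ.≤ q ⊎ q ℚ.≤ x ℚ^.^ n → _
  go (inj₁ xⁿ≤q) = power-between 0≤x x≤1 q≤1 0≤q n xⁿ≤q
  go (inj₂ q≤xⁿ) = suc n , xⁿ⁺¹≤q , *-monoˡ 0≤x q≤xⁿ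

power-gap : ∀ a d a′ d′ → suc (a ℕ.* suc d′) ℕ.≤ a′ ℕ.* suc d →
            ∃[ r ] ∃[ j ] 0ℚ ℚ.< r × r ℚ.< 1ℚ ×
              (r ℚ^.^ j) ℚ^.^ suc d ℚ.≤ ½ ℚ^.^ a ×
              ½ ℚ^.^ a′ ℚ.≤ (r ℚ.* (r ℚ.* r ℚ^.^ j)) ℚ^.^ suc d′
power-gap a d a′ d′ ad′<a′d =
  let r , 0<r , r<1 , ½≤rⁿ = near-one (suc d ℕ.* (3 ℕ.* suc d′)) in
  gap r 0<r r<1 ½≤rⁿ
  where
  open ℚ.≤-Reasoning
  D = suc d
  D′ = suc d′

  gap : ∀ r → 0ℚ ℚ.< r → r ℚ.< 1ℚ → ½ ℚ.≤ r ℚ^.^ (D ℕ.* (3 ℕ.* D′)) →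
        ∃[ r ] ∃[ j ] 0ℚ ℚ.< r × r ℚ.< 1ℚ × (r ℚ^.^ j) ℚ^.^ D ℚ.≤ ½ ℚ^.^ a ×
        ½ ℚ^.^ a′ ℚ.≤ (r ℚ.* (r ℚ.* r ℚ^.^ j)) ℚ^.^ D′
  gap r 0<r r<1 ½≤rⁿ =
    let n , xⁿ≤½ᵃ = powers-vanish 0<x x<1 (^-pos a 0<½)
        j , xʲ≤½ᵃ , x½ᵃ≤xʲ = power-between 0≤x (ℚ.<⇒≤ x<1) ½ᵃ≤1 (ℚ.<⇒≤ (^-pos a 0<½)) n xⁿ≤½ᵃ
    in r , j , 0<r , r<1 , subst (ℚ._≤ ½ ℚ^.^ a) (^-comm r D j) xʲ≤½ᵃ , ½ᵃ′≤ j x½ᵃ≤xʲ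
    where
    0≤r = ℚ.<⇒≤ 0<r
    ρ = r ℚ^.^ D
    0<x = ^-pos D 0<r
    0≤x = ℚ.<⇒≤ 0<x
    x<1 : ρ ℚ.< 1ℚ
    x<1 = subst (ρ ℚ.<_) (1^n≡1 D) (^-mono-< d 0≤r r<1)
    ½ᵃ≤1 : ½ ℚ^.^ a ℚ.≤ 1ℚ
    ½ᵃ≤1 = ^-antitone 0≤½ ½≤1 (ℕ.z≤n {a})
    ½ᵃ′≤ : ∀ j → ρ ℚ.* ½ ℚ^.^ a ℚ.≤ ρ ℚ^.^ j → ½ ℚ^.^ a′ ℚ.≤ (r ℚ.* (r ℚ.* r ℚ^.^ j)) ℚ^.^ D′
    -- The two sides are compared after raising to the power `D`; this clears the denominators, and
    -- the hypothesis on `a` and `a′` becomes one spare factor ½.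
    ½ᵃ′≤ j x½ᵃ≤xʲ = ^-cancel d (^-nonNeg D′ (*-nonNeg 0≤r (*-nonNeg 0≤r (^-nonNeg j 0≤r)))) (begin
      (½ ℚ^.^ a′) ℚ^.^ D                            ≡⟨ ℚ^.^-assocʳ ½ a′ D ⟩
      ½ ℚ^.^ (a′ ℕ.* D)                             ≤⟨ ^-antitone 0≤½ ½≤1 ad′<a′d ⟩
      ½ ℚ.* ½ ℚ^.^ (a ℕ.* D′)                       ≡⟨ cong (½ ℚ.*_) (ℚ^.^-assocʳ ½ a D′) ⟨
      ½ ℚ.* (½ ℚ^.^ a) ℚ^.^ D′                      ≤⟨ *-monoʳ (^-nonNeg D′ (^-nonNeg a 0≤½)) ½≤rⁿ ⟩
      r ℚ^.^ (D ℕ.* (3 ℕ.* D′)) ℚ.* (½ ℚ^.^ a) ℚ^.^ D′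
        ≡⟨ cong (ℚ._* (½ ℚ^.^ a) ℚ^.^ D′) (ℚ^.^-assocʳ r D (3 ℕ.* D′)) ⟨
      ρ ℚ^.^ (3 ℕ.* D′) ℚ.* (½ ℚ^.^ a) ℚ^.^ D′
        ≡⟨ cong (ℚ._* (½ ℚ^.^ a) ℚ^.^ D′) (ℚ^.^-assocʳ ρ 3 D′) ⟨
      (ρ ℚ^.^ 3) ℚ^.^ D′ ℚ.* (½ ℚ^.^ a) ℚ^.^ D′    ≡⟨ ℚ^.^-distrib-* (ρ ℚ^.^ 3) (½ ℚ^.^ a) D′ ⟨
      (ρ ℚ^.^ 3 ℚ.* ½ ℚ^.^ a) ℚ^.^ D′
        ≤⟨ ^-mono D′ (*-nonNeg (^-nonNeg 3 0≤x) (^-nonNeg a 0≤½)) (begin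
          ρ ℚ^.^ 3 ℚ.* ½ ℚ^.^ a                     ≡⟨ cube ρ (½ ℚ^.^ a) ⟩
          ρ ℚ.* (ρ ℚ.* (ρ ℚ.* ½ ℚ^.^ a))            ≤⟨ *-monoˡ 0≤x (*-monoˡ 0≤x x½ᵃ≤xʲ) ⟩
          ρ ℚ^.^ (2 ℕ.+ j)                          ∎) ⟩
      (ρ ℚ^.^ (2 ℕ.+ j)) ℚ^.^ D′                    ≡⟨ cong (ℚ^._^ D′) (^-comm r D (2 ℕ.+ j)) ⟩
      ((r ℚ^.^ (2 ℕ.+ j)) ℚ^.^ D) ℚ^.^ D′           ≡⟨ ^-comm (r ℚ^.^ (2 ℕ.+ j)) D D′ ⟩
      ((r ℚ^.^ (2 ℕ.+ j)) ℚ^.^ D′) ℚ^.^ D           ∎)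
      where
      cube : ∀ ρ h → ρ ℚ^.^ 3 ℚ.* h ≡ ρ ℚ.* (ρ ℚ.* (ρ ℚ.* h))
      cube ρ h = solve 2 (λ ρ h → ρ :* (ρ :* (ρ :* con 1ℚ)) :* h := ρ :* (ρ :* (ρ :* h))) refl ρ h

-- Approximation of sums and products from below.

<-≤-connex : ∀ p q → p ℚ.< q ⊎ q ℚ.≤ p
<-≤-connex p q with p ℚ.<? q
... | yes p<q = inj₁ p<q
... | no  p≮q = inj₂ (ℚ.≮⇒≥ p≮q)

+-approxˡ : p ℚ.< q ℚ.+ z → ∃[ q′ ] q′ ℚ.< q × p ℚ.< q′ ℚ.+ z
+-approxˡ {p} {q} {z} p<q+z =
  let q′ , p-z<q′ , q′<q = ℚ.<-dense (subst (p ℚ.- z ℚ.<_) (cancel q) (ℚ.+-monoˡ-< (ℚ.- z) p<q+z))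
  in q′ , q′<q , subst (ℚ._< q′ ℚ.+ z) (trans (ℚ.+-comm (p ℚ.- z) z) (p+[q-p]≡q z p))
                   (ℚ.+-monoˡ-< z p-z<q′)
  where
  cancel : ∀ q → q ℚ.+ z ℚ.- z ≡ q
  cancel q =
    trans (ℚ.+-assoc q z (ℚ.- z)) (trans (cong (q ℚ.+_) (ℚ.+-inverseʳ z)) (ℚ.+-identityʳ q))

+-approx : p ℚ.< q ℚ.+ z → ∃[ q′ ] ∃[ z′ ] q′ ℚ.< q × z′ ℚ.< z × p ℚ.< q′ ℚ.+ z′
+-approx {p} {q} {z} p<q+z =
  let q′ , q′<q , p<q′+z = +-approxˡ p<q+z
      z′ , z′<z , p<z′+q′ = +-approxˡ (subst (p ℚ.<_) (ℚ.+-comm q′ z) p<q′+z)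
  in q′ , z′ , q′<q , z′<z , subst (p ℚ.<_) (ℚ.+-comm z′ q′) p<z′+q′

*-approxˡ : 0ℚ ℚ.< z → p ℚ.< q ℚ.* z → ∃[ q′ ] q′ ℚ.< q × p ℚ.< q′ ℚ.* z
*-approxˡ {z} {p} {q} 0<z p<qz =
  let q′ , p/z<q′ , q′<q = ℚ.<-dense (subst (p ℚ.* ℚ.1/ z ℚ.<_) (cancel q (ℚ.*-inverseʳ z))
                             (ℚ.*-monoˡ-<-pos (ℚ.1/ z) p<qz))
  in q′ , q′<q , subst (ℚ._< q′ ℚ.* z) (cancel p (ℚ.*-inverseˡ z)) (ℚ.*-monoˡ-<-pos z p/z<q′)
  where
  instance
    z-pos = ℚ.positive 0<z
    z≢0 = ℚ.pos⇒nonZero z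
    1/z-pos = ℚ.1/pos⇒pos z
  cancel : ∀ {s s′} q → s ℚ.* s′ ≡ 1ℚ → q ℚ.* s ℚ.* s′ ≡ q
  cancel {s} {s′} q ss′≡1 =
    trans (ℚ.*-assoc q s s′) (trans (cong (q ℚ.*_) ss′≡1) (ℚ.*-identityʳ q))

*-pos-factor : 0ℚ ℚ.≤ z → 0ℚ ℚ.≤ p → p ℚ.< q ℚ.* z → 0ℚ ℚ.< q
*-pos-factor {z} {p} {q} 0≤z 0≤p p<qz = ℚ.≰⇒> λ q≤0 →
  ℚ.<-irrefl refl (ℚ.<-≤-trans p<qz (ℚ.≤-trans
    (subst (q ℚ.* z ℚ.≤_) (ℚ.*-zeroˡ z) (*-monoʳ 0≤z q≤0)) 0≤p))

-- First `q` is lowered with `z` fixed, then `z` with the lowered `q′` fixed. Since 0 ≤ p, the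
-- factor kept fixed is positive each time and can be divided by.
*-approx : 0ℚ ℚ.≤ q → 0ℚ ℚ.≤ z → 0ℚ ℚ.≤ p → p ℚ.< q ℚ.* z →
           ∃[ q′ ] ∃[ z′ ] 0ℚ ℚ.≤ q′ × q′ ℚ.< q × 0ℚ ℚ.≤ z′ × z′ ℚ.< z × p ℚ.< q′ ℚ.* z′
*-approx {q} {z} {p} 0≤q 0≤z 0≤p p<qz =
  let 0<z = *-pos-factor 0≤q 0≤p (subst (p ℚ.<_) (ℚ.*-comm q z) p<qz)
      q′ , q′<q , p<q′z = *-approxˡ 0<z p<qz
      0<q′ = *-pos-factor 0≤z 0≤p p<q′z
      z′ , z′<z , p<z′q′ = *-approxˡ 0<q′ (subst (p ℚ.<_) (ℚ.*-comm q′ z) p<q′z)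
      0<z′ = *-pos-factor (ℚ.<⇒≤ 0<q′) 0≤p p<z′q′
  in q′ , z′ , ℚ.<⇒≤ 0<q′ , q′<q , ℚ.<⇒≤ 0<z′ , z′<z , subst (p ℚ.<_) (ℚ.*-comm z′ q′) p<z′q′

powers-vanish-* : 0ℚ ℚ.< x → x ℚ.< 1ℚ → 0ℚ ℚ.< p → 0ℚ ℚ.< q → ∃[ n ] x ℚ^.^ n ℚ.* p ℚ.≤ q
powers-vanish-* {x} {p} {q} 0<x x<1 0<p 0<q =
  let n , xⁿ≤q/p = powers-vanish 0<x x<1 (*-pos 0<q (ℚ.positive⁻¹ (ℚ.1/ p)))
  in n , subst (x ℚ^.^ n ℚ.* p ℚ.≤_) q/p*p≡q (*-monoʳ (ℚ.<⇒≤ 0<p) xⁿ≤q/p)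
  where
  instance
    p-pos = ℚ.positive 0<p
    p≢0 = ℚ.pos⇒nonZero p
    1/p-pos = ℚ.1/pos⇒pos p
  q/p*p≡q : q ℚ.* ℚ.1/ p ℚ.* p ≡ q
  q/p*p≡q = trans (ℚ.*-assoc q (ℚ.1/ p) p)
    (trans (cong (q ℚ.*_) (ℚ.*-inverseˡ p)) (ℚ.*-identityʳ q))

-- Rational bounds on cuts

-- The embedding of the nonnegative rationals. A negative `q` is sent to 0, since every cut contains
-- all negative rationals.
ι : ℚ → ℝ≥0∞ 0ℓ
ι q = ⋁ (_≡ q)

below-ι⁺ : p ℚ.< q → below (ι q) p
below-ι⁺ p<q = inj₂ (_ , refl , p<q)

below-ι⁻ : 0ℚ ℚ.≤ q → below (ι q) p → p ℚ.< q
below-ι⁻ 0≤q (inj₁ p<0) = ℚ.<-≤-trans p<0 0≤q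
below-ι⁻ 0≤q (inj₂ (_ , refl , p<q)) = p<q

ι-least : (x : ℝ≥0∞ ℓ) → (∀ {p} → 0ℚ ℚ.≤ p → p ℚ.< q → below x p) → ι q ≤ x
ι-least x q≤x (inj₁ p<0) = negative x p<0
ι-least x q≤x {p} (inj₂ (_ , refl , p<q)) = decide (<-≤-connex p 0ℚ)
  where
  decide : p ℚ.< 0ℚ ⊎ 0ℚ ℚ.≤ p → below x p
  decide (inj₁ p<0) = negative x p<0
  decide (inj₂ 0≤p) = q≤x 0≤p p<q

+-ι-lower : (x y : ℝ≥0∞ ℓ) → ι u ≤ x → ι v ≤ y → ι (u ℚ.+ v) ≤ x + y
+-ι-lower x y u≤x v≤y = ι-least (x + y) λ _ p<u+v →
  let u′ , v′ , u′<u , v′<v , p<u′+v′ = +-approx p<u+v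
  in inj₂ (u′ ℚ.+ v′ , (u′ , v′ , u≤x (below-ι⁺ u′<u) , v≤y (below-ι⁺ v′<v) , refl) , p<u′+v′)

*-ι-lower : (x y : ℝ≥0∞ ℓ) → 0ℚ ℚ.≤ u → 0ℚ ℚ.≤ v → ι u ≤ x → ι v ≤ y → ι (u ℚ.* v) ≤ x * y
*-ι-lower x y 0≤u 0≤v u≤x v≤y = ι-least (x * y) λ 0≤p p<uv →
  let u′ , v′ , 0≤u′ , u′<u , 0≤v′ , v′<v , p<u′v′ = *-approx 0≤u 0≤v 0≤p p<uv
  in inj₂ (u′ ℚ.* v′ ,
       (u′ , v′ , 0≤u′ , u≤x (below-ι⁺ u′<u) , 0≤v′ , v≤y (below-ι⁺ v′<v) , refl) , p<u′v′)

^-ι-lower : (x : ℝ≥0∞ 0ℓ) → 0ℚ ℚ.≤ u → ι u ≤ x → ∀ n → ι (u ℚ^.^ n) ≤ x ^ n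
^-ι-lower x 0≤u u≤x zero    = λ p → p
^-ι-lower x 0≤u u≤x (suc n) =
  *-ι-lower x (x ^ n) 0≤u (^-nonNeg n 0≤u) u≤x (^-ι-lower x 0≤u u≤x n)

+-ι-upper : (x y : ℝ≥0∞ ℓ) → 0ℚ ℚ.≤ u → 0ℚ ℚ.≤ v → x ≤ ι u → y ≤ ι v → x + y ≤ ι (u ℚ.+ v)
+-ι-upper x y 0≤u 0≤v x≤u y≤v (inj₁ q<0) = inj₁ q<0
+-ι-upper x y 0≤u 0≤v x≤u y≤v (inj₂ (_ , (p , p′ , p<x , p′<y , refl) , q<p+p′)) =
  below-ι⁺ (ℚ.<-trans q<p+p′ (ℚ.+-mono-< (below-ι⁻ 0≤u (x≤u p<x)) (below-ι⁻ 0≤v (y≤v p′<y))))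

*-ι-upper : (x y : ℝ≥0∞ ℓ) → 0ℚ ℚ.≤ u → 0ℚ ℚ.≤ v → x ≤ ι u → y ≤ ι v → x * y ≤ ι (u ℚ.* v)
*-ι-upper x y 0≤u 0≤v x≤u y≤v (inj₁ q<0) = inj₁ q<0
*-ι-upper x y 0≤u 0≤v x≤u y≤v (inj₂ (_ , (p , p′ , 0≤p , p<x , 0≤p′ , p′<y , refl) , q<pp′)) =
  below-ι⁺ (ℚ.<-≤-trans q<pp′
    (*-mono 0≤p 0≤v (ℚ.<⇒≤ (below-ι⁻ 0≤u (x≤u p<x))) (ℚ.<⇒≤ (below-ι⁻ 0≤v (y≤v p′<y)))))

^-ι-upper : (x : ℝ≥0∞ 0ℓ) → 0ℚ ℚ.≤ u → x ≤ ι u → ∀ n → x ^ n ≤ ι (u ℚ^.^ n)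
^-ι-upper x 0≤u x≤u zero    = λ p → p
^-ι-upper x 0≤u x≤u (suc n) =
  *-ι-upper x (x ^ n) 0≤u (^-nonNeg n 0≤u) x≤u (^-ι-upper x 0≤u x≤u n)

⋁-least : ∀ {B : ℚ → Set ℓ} (y : ℝ≥0∞ ℓ′) → (∀ {b} → B b → below y b) → ⋁ B ≤ y
⋁-least y B≤y (inj₁ q<0) = negative y q<0
⋁-least y B≤y (inj₂ (b , b∈B , q<b)) = lower y (ℚ.<⇒≤ q<b) (B≤y b∈B)

below-⨅ : ∀ {I : Set ℓ′} (x : I → ℝ≥0∞ ℓ) i → ⨅ x ≤ x i
below-⨅ x i = ⋁-least (x i) λ b<x → b<x i

below-0#⁻ : below 0# q → q ℚ.< 0ℚ
below-0#⁻ (inj₁ q<0) = q<0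
below-0#⁻ (inj₂ (_ , () , _))

0#-least : (x : ℝ≥0∞ ℓ) → 0# ≤ x
0#-least x q<0 = negative x (below-0#⁻ q<0)

series-≤0 : (x : ℕ → ℝ≥0∞ ℓ) → (∀ n → x n ≤ 0#) → series x ≤ 0#
series-≤0 x x≤0 = ⋁-least 0# λ (n , b<Σ) → partialSum-≤0 n b<Σ
  where
  partialSum-≤0 : ∀ n → partialSum x n ≤ 0#
  partialSum-≤0 zero    = x≤0 0
  partialSum-≤0 (suc n) = ⋁-least 0# λ { (p , q , p<Σ , q<x , refl) →
    inj₁ (ℚ.+-mono-< (below-0#⁻ (partialSum-≤0 n p<Σ)) (below-0#⁻ (x≤0 (suc n) q<x))) }

term≤series : (x : ℕ → ℝ≥0∞ ℓ) → ∀ n → x n ≤ series x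
term≤series x n p<x =
  let q , p<q , q<Σ = rounded (partialSum x n) (term≤partialSum n p<x) in inj₂ (q , (n , q<Σ) , p<q)
  where
  term≤partialSum : ∀ n → x n ≤ partialSum x n
  term≤partialSum zero    p<x = p<x
  term≤partialSum (suc n) p<x =
    -- The sum of cuts needs a rational strictly above `p`, which roundedness of the last term
    -- supplies; the preceding partial sum is estimated by 0.
    let q , p<q , q<x = rounded (x (suc n)) p<x in
    +-ι-lower {u = 0ℚ} {v = q} (partialSum x n) (x (suc n))
      (ι-least (partialSum x n) λ 0≤p p<0 → contradiction (ℚ.≤-<-trans 0≤p p<0) (ℚ.<-irrefl refl))
      (ι-least (x (suc n)) λ _ p<q → lower (x (suc n)) (ℚ.<⇒≤ p<q) q<x)
      (below-ι⁺ (subst (_ ℚ.<_) (sym (ℚ.+-identityˡ q)) p<q))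

-- The exponents t for which 2⁻ᵗ is rational

infix 8 _÷_

_÷_ : ℕ → ℕ → ℚ
m ÷ n = ℤ.+ m ℚ./ suc n

÷-nonNeg : ∀ m n → 0ℚ ℚ.≤ m ÷ n
÷-nonNeg m n = ℚ.nonNegative⁻¹ (m ÷ n) {{ℚ.normalize-nonNeg m (suc n)}}

toℚᵘ-÷ : ∀ m n → ℚ.toℚᵘ (m ÷ n) ℚᵘ.≃ ℚᵘ.mkℚᵘ (ℤ.+ m) n
toℚᵘ-÷ m n = ℚ.toℚᵘ-fromℚᵘ (ℚᵘ.mkℚᵘ (ℤ.+ m) n)

÷-cross⁻ : ∀ m n m′ n′ → m ÷ n ℚ.< m′ ÷ n′ → m ℕ.* suc n′ ℕ.< m′ ℕ.* suc n
÷-cross⁻ m n m′ n′ m/n<m′/n′ = ℤ.drop‿+<+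
  (subst₂ ℤ._<_ (sym (ℤ.pos-* m (suc n′))) (sym (ℤ.pos-* m′ (suc n))) (ℚᵘ.drop-*<* (begin-strict
    ℚᵘ.mkℚᵘ (ℤ.+ m) n     ≃⟨ toℚᵘ-÷ m n ⟨
    ℚ.toℚᵘ (m ÷ n)        <⟨ ℚ.toℚᵘ-mono-< m/n<m′/n′ ⟩
    ℚ.toℚᵘ (m′ ÷ n′)      ≃⟨ toℚᵘ-÷ m′ n′ ⟩
    ℚᵘ.mkℚᵘ (ℤ.+ m′) n′   ∎)))
  where open ℚᵘ.≤-Reasoning

÷-cross⁺ : ∀ m n m′ n′ → m ℕ.* suc n′ ℕ.< m′ ℕ.* suc n → m ÷ n ℚ.< m′ ÷ n′
÷-cross⁺ m n m′ n′ mn′<m′n = ℚ.toℚᵘ-cancel-< (begin-strict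
  ℚ.toℚᵘ (m ÷ n)        ≃⟨ toℚᵘ-÷ m n ⟩
  ℚᵘ.mkℚᵘ (ℤ.+ m) n
    <⟨ ℚᵘ.*<* (subst₂ ℤ._<_ (ℤ.pos-* m (suc n′)) (ℤ.pos-* m′ (suc n)) (ℤ.+<+ mn′<m′n)) ⟩
  ℚᵘ.mkℚᵘ (ℤ.+ m′) n′   ≃⟨ toℚᵘ-÷ m′ n′ ⟨
  ℚ.toℚᵘ (m′ ÷ n′)      ∎)
  where open ℚᵘ.≤-Reasoning

as-÷ : 0ℚ ℚ.≤ q → ∃[ m ] ∃[ n ] q ≡ m ÷ n
as-÷ {mkℚ (ℤ.+ m) d c} _ = m , d , sym (ℚ.↥p/↧p≡p (mkℚ (ℤ.+ m) d c))
as-÷ {mkℚ (ℤ.-[1+ m ]) d c} (ℚ.*≤* ())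

-- log₂ (1/β): m/n lies below it when 2^(m/n) ≤ 1/β, that is βⁿ ≤ ½ᵐ.

log½ : ℚ → ℝ≥0∞ 0ℓ
log½ β = ⋁ λ b → ∃[ m ] ∃[ n ] b ≡ m ÷ n × β ℚ^.^ suc n ℚ.≤ ½ ℚ^.^ m

½^-cancel : ∀ m n → ½ ℚ^.^ m ℚ.≤ ½ ℚ^.^ n → n ℕ.≤ m
½^-cancel m n ½ᵐ≤½ⁿ = ℕ.≮⇒≥ λ m<n →
  ℚ.<-irrefl refl (ℚ.<-≤-trans (half m) (ℚ.≤-trans ½ᵐ≤½ⁿ (^-antitone 0≤½ ½≤1 m<n)))
  where
  half : ∀ m → ½ ℚ.* ½ ℚ^.^ m ℚ.< ½ ℚ^.^ m
  half m = subst (½ ℚ.* ½ ℚ^.^ m ℚ.<_) (ℚ.*-identityˡ (½ ℚ^.^ m))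
    (ℚ.*-monoˡ-<-pos (½ ℚ^.^ m) {{ℚ.positive (^-pos m 0<½)}} ½<1)

-- Raising both bounds on `β` to a common power gives ½^(m(n′+1)) ≤ ½^(m′(n+1)), so no fraction
-- m′/(n′+1) that generates the cut exceeds m/(n+1).
log½-upper : ∀ {β} m n → 0ℚ ℚ.< β → ½ ℚ^.^ m ℚ.≤ β ℚ^.^ suc n → ¬ below (log½ β) (m ÷ n)
log½-upper m n 0<β ½ᵐ≤βⁿ (inj₁ m/n<0) = ℚ.<-irrefl refl (ℚ.<-≤-trans m/n<0 (÷-nonNeg m n))
log½-upper {β} m n 0<β ½ᵐ≤βⁿ (inj₂ (_ , (m′ , n′ , refl , βⁿ′≤½ᵐ′) , m/n<m′/n′)) =
  ℕ.<⇒≱ (÷-cross⁻ m n m′ n′ m/n<m′/n′) (½^-cancel (m ℕ.* suc n′) (m′ ℕ.* suc n) (begin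
    ½ ℚ^.^ (m ℕ.* suc n′)         ≡⟨ ℚ^.^-assocʳ ½ m (suc n′) ⟨
    (½ ℚ^.^ m) ℚ^.^ suc n′        ≤⟨ ^-mono (suc n′) (^-nonNeg m 0≤½) ½ᵐ≤βⁿ ⟩
    (β ℚ^.^ suc n) ℚ^.^ suc n′    ≡⟨ ^-comm β (suc n) (suc n′) ⟩
    (β ℚ^.^ suc n′) ℚ^.^ suc n    ≤⟨ ^-mono (suc n) (^-nonNeg (suc n′) (ℚ.<⇒≤ 0<β)) βⁿ′≤½ᵐ′ ⟩
    (½ ℚ^.^ m′) ℚ^.^ suc n        ≡⟨ ℚ^.^-assocʳ ½ m′ (suc n) ⟩
    ½ ℚ^.^ (m′ ℕ.* suc n)         ∎))
  where open ℚ.≤-Reasoning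

module _ {β : ℚ} (0<β : 0ℚ ℚ.< β) (β≤1 : β ℚ.≤ 1ℚ)
         (t : ℝ≥0) (t≡log : value t ≡ log½ β) where
  open ℚ.≤-Reasoning

  2^-log½-upper : 2^- t ≤ ι β
  2^-log½-upper (inj₁ q<0) = inj₁ q<0
  2^-log½-upper (inj₂ (b , (0≤b , m , n , t≤m/n , bⁿ≤½ᵐ) , q<b)) =
    below-ι⁺ (ℚ.<-≤-trans q<b (ℚ.≮⇒≥ λ β<b → t≤m/n (m/n<t β<b)))
    where
    m/n<t : β ℚ.< b → below (value t) (m ÷ n)
    m/n<t β<b = let k , sep = powers-separate (^-pos (suc n) 0<β) (^-mono-< n (ℚ.<⇒≤ 0<β) β<b) 0<½
                in witness k sep
      where
      witness : ∀ k → (β ℚ^.^ suc n) ℚ^.^ suc k ℚ.≤ ½ ℚ.* (b ℚ^.^ suc n) ℚ^.^ suc k →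
                below (value t) (m ÷ n)
      witness k sep = subst (λ x → below x (m ÷ n)) (sym t≡log)
        (inj₂ (m′ ÷ n′ , (m′ , n′ , refl , βⁿ′≤½ᵐ′) , ÷-cross⁺ m n m′ n′ cross))
        where
        -- The fraction is (m(k+1) + 1)/((n+1)(k+1)); `n′` is written so that `suc n′` computes to
        -- `suc n ℕ.* suc k`.
        m′ = suc (m ℕ.* suc k)
        n′ = k ℕ.+ n ℕ.* suc k
        βⁿ′≤½ᵐ′ : β ℚ^.^ (suc n ℕ.* suc k) ℚ.≤ ½ ℚ^.^ suc (m ℕ.* suc k)
        βⁿ′≤½ᵐ′ = begin
          β ℚ^.^ (suc n ℕ.* suc k)              ≡⟨ ℚ^.^-assocʳ β (suc n) (suc k) ⟨
          (β ℚ^.^ suc n) ℚ^.^ suc k             ≤⟨ sep ⟩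
          ½ ℚ.* (b ℚ^.^ suc n) ℚ^.^ suc k
            ≤⟨ *-monoˡ 0≤½ (^-mono (suc k) (^-nonNeg (suc n) 0≤b) bⁿ≤½ᵐ) ⟩
          ½ ℚ.* (½ ℚ^.^ m) ℚ^.^ suc k           ≡⟨ cong (½ ℚ.*_) (ℚ^.^-assocʳ ½ m (suc k)) ⟩
          ½ ℚ^.^ suc (m ℕ.* suc k)              ∎
        cross : m ℕ.* (suc n ℕ.* suc k) ℕ.< suc (m ℕ.* suc k) ℕ.* suc n
        cross = subst (ℕ._< suc (m ℕ.* suc k) ℕ.* suc n)
          (trans (ℕ.*-assoc m (suc k) (suc n)) (cong (m ℕ.*_) (ℕ.*-comm (suc k) (suc n))))
          (ℕ.m<n+m (m ℕ.* suc k ℕ.* suc n) ℕ.z<s)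

  -- For b < β some power satisfies b^(n+1) ≤ ½β^(n+1). Rounding β^(n+1) down to a power ½ᵐ costs at
  -- most a factor ½, so b^(n+1) ≤ ½ᵐ ≤ β^(n+1). The second inequality gives t ≤ m/(n+1), and the
  -- first then admits `b` in 2⁻ᵗ.
  2^-log½-lower : ι β ≤ 2^- t
  2^-log½-lower = ι-least (2^- t) λ 0≤q q<β →
    let b , q<b , b<β = ℚ.<-dense q<β
        0<b = ℚ.≤-<-trans 0≤q q<b
        n , bⁿ≤½βⁿ = powers-separate 0<b b<β 0<½
        0<βⁿ = ^-pos (suc n) 0<β
        k , ½ᵏ≤βⁿ = powers-vanish 0<½ ½<1 0<βⁿ
        m , ½ᵐ≤βⁿ , ½βⁿ≤½ᵐ = power-between 0≤½ ½≤1
          (^-antitone (ℚ.<⇒≤ 0<β) β≤1 (ℕ.z≤n {suc n})) (ℚ.<⇒≤ 0<βⁿ) k ½ᵏ≤βⁿ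
    in inj₂ (b , (ℚ.<⇒≤ 0<b , m , n ,
         subst (λ x → ¬ below x (m ÷ n)) (sym t≡log) (log½-upper m n 0<β ½ᵐ≤βⁿ) ,
         ℚ.≤-trans bⁿ≤½βⁿ ½βⁿ≤½ᵐ) , q<b)

-- `β` is the rational value of 2⁻ᵗ. Of its two factors `r` over `σ`, one makes the sums decay
-- geometrically; the other pays for the growing weights r⁻ⁿ in the gale built from a cover.
record LargerExponent (s : ℝ≥0) (q : ℚ) : Set₁ where
  field
    t       : ℝ≥0
    t≤q     : ¬ below (value t) q
    r σ     : ℚ
    0<r     : 0ℚ ℚ.< r
    r<1     : r ℚ.< 1ℚ
    0<σ     : 0ℚ ℚ.< σ
    σ≤2^-s  : ι σ ≤ 2^- s

  β : ℚ
  β = r ℚ.* (r ℚ.* σ)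

  0<β : 0ℚ ℚ.< β
  0<β = *-pos 0<r (*-pos 0<r 0<σ)

  field
    β≤2^-t  : ι β ≤ 2^- t
    2^-t≤β  : 2^- t ≤ ι β

-- `power-gap` yields σ = rʲ with σ ≤ 2^(-q) and r²σ ≥ 2^(-q′). The first bound puts `σ` below 2⁻ˢ
-- because s ≤ q. With t = log₂(1/(r²σ)) the second bound says t ≤ q′.
largerExponent : ∀ s → ¬ below (value s) q → q ℚ.< q′ → LargerExponent s q′
largerExponent {q} {q′} s s≤q q<q′ =
  let 0≤q = ℚ.≮⇒≥ (s≤q ∘ negative (value s))
      a , d , q≡a/d = as-÷ 0≤q
      a′ , d′ , q′≡a′/d′ = as-÷ (ℚ.≤-trans 0≤q (ℚ.<⇒≤ q<q′))
      r , j , 0<r , r<1 , σᵈ≤½ᵃ , ½ᵃ′≤βᵈ′ =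
        power-gap a d a′ d′ (÷-cross⁻ a d a′ d′ (subst₂ ℚ._<_ q≡a/d q′≡a′/d′ q<q′))
  in build a d a′ d′ q≡a/d q′≡a′/d′ r j 0<r r<1 σᵈ≤½ᵃ ½ᵃ′≤βᵈ′
  where
  build : ∀ a d a′ d′ → q ≡ a ÷ d → q′ ≡ a′ ÷ d′ →
          ∀ r j → 0ℚ ℚ.< r → r ℚ.< 1ℚ → (r ℚ^.^ j) ℚ^.^ suc d ℚ.≤ ½ ℚ^.^ a →
          ½ ℚ^.^ a′ ℚ.≤ (r ℚ.* (r ℚ.* r ℚ^.^ j)) ℚ^.^ suc d′ →
          LargerExponent s q′
  build a d a′ d′ q≡a/d q′≡a′/d′ r j 0<r r<1 σᵈ≤½ᵃ ½ᵃ′≤βᵈ′ = record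
    { t = t ; t≤q = t≤q′ ; r = r ; σ = r ℚ^.^ j ; 0<r = 0<r ; r<1 = r<1 ; 0<σ = ^-pos j 0<r
    ; σ≤2^-s = λ { (inj₁ p<0) → inj₁ p<0
                 ; (inj₂ (_ , refl , p<σ)) → inj₂ (r ℚ^.^ j , (ℚ.<⇒≤ (^-pos j 0<r) , a , d ,
                     subst (λ q → ¬ below (value s) q) q≡a/d s≤q , σᵈ≤½ᵃ) , p<σ) }
    ; β≤2^-t = 2^-log½-lower 0<b b≤1 t refl
    ; 2^-t≤β = 2^-log½-upper 0<b b≤1 t refl
    }
    where
    b = r ℚ.* (r ℚ.* r ℚ^.^ j)
    0<b = ^-pos (2 ℕ.+ j) 0<r
    b≤1 : b ℚ.≤ 1ℚ
    b≤1 = ^-antitone (ℚ.<⇒≤ 0<r) (ℚ.<⇒≤ r<1) (ℕ.z≤n {2 ℕ.+ j})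
    t≤q′ : ¬ below (log½ b) q′
    t≤q′ = subst (λ q → ¬ below (log½ b) q) (sym q′≡a′/d′) (log½-upper a′ d′ 0<b ½ᵃ′≤βᵈ′)
    t : ℝ≥0
    t = record { value = log½ b ; finite = q′ , t≤q′ }

-- Comparison of infima under excluded middle.

module Classical (em : ExcludedMiddle (lsuc 0ℓ)) where

  em₀ : {A : Set} → Dec A
  em₀ {A} = map′ Lift.lower lift (em {Lift (lsuc 0ℓ) A})

  -- If some s in `Φ` were at most `c`, where c < b and `b` lies below all of `Ψ`, then `step` would
  -- produce an element of `Ψ` that is at most `b`. The intermediate `c` provides the strict gap
  -- that `largerExponent` requires.
  inf-mono : (Φ Ψ : Pred ℝ≥0 (lsuc 0ℓ)) →
             (∀ s {q} → Φ s → LargerExponent s q → ∃[ t ] Ψ t × ¬ below (value t) q) →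
             inf Ψ ≤ inf Φ
  inf-mono Φ Ψ step (inj₁ q<0) = inj₁ q<0
  inf-mono Φ Ψ step (inj₂ (b , b<Ψ , q<b)) =
    let c , q<c , c<b = ℚ.<-dense q<b
    in inj₂ (c , (λ (s , Φs) → decidable-stable em₀ λ s≤c →
         let t , Ψt , t≤b = step s Φs (largerExponent s s≤c c<b)
         in t≤b (b<Ψ (t , Ψt))) , q<c)

-- Kraft's inequality for gales

Incomparable : Rel String 0ℓ
Incomparable v w = ¬ Prefix _≡_ v w × ¬ Prefix _≡_ w v

prefixSet⇒incomparable : ∀ {A ws} → IsPrefixSet A → All A ws → Unique ws → AllPairs Incomparable ws
prefixSet⇒incomparable pf []           []             = []
prefixSet⇒incomparable pf (w∈A ∷ ws⊆A) (w≢ws ∷ uniq) =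
  All.zipWith (λ (v∈A , w≢v) → (w≢v ∘ pf w∈A v∈A) , (w≢v ∘ sym ∘ pf v∈A w∈A)) (ws⊆A , w≢ws)
  ∷ prefixSet⇒incomparable pf ws⊆A uniq

-- The empty string is a prefix of every string, so it can only occur alone. This is the case split
-- of the Kraft induction: the root itself, or strings that all continue into a child.
incomparable-[] : ∀ {ws} → AllPairs Incomparable ws → ws ≡ [] ∷ [] ⊎ All (_≢ []) ws
incomparable-[] []                                = inj₂ []
incomparable-[] {[] ∷ []}      (_ ∷ _)            = inj₁ refl
incomparable-[] {[] ∷ _ ∷ _}   ((inc ∷ _) ∷ _)    = contradiction [] (proj₁ inc)
incomparable-[] {(_ ∷ _) ∷ ws} (incs ∷ pairs) with incomparable-[] pairs | incs
... | inj₁ refl | inc ∷ _ = contradiction [] (proj₂ inc)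
... | inj₂ ne   | _       = inj₂ ((λ ()) ∷ ne)

strip : Bool → List String → List String
strip b           []                   = []
strip b           ([] ∷ ws)            = strip b ws
strip false       ((false ∷ w) ∷ ws)   = w ∷ strip false ws
strip false       ((true  ∷ w) ∷ ws)   = strip false ws
strip true        ((false ∷ w) ∷ ws)   = strip true ws
strip true        ((true  ∷ w) ∷ ws)   = w ∷ strip true ws

All-strip : ∀ {Φ : Pred String ℓ} b ws → All Φ ws → All (Φ ∘ (b ∷_)) (strip b ws)
All-strip b     []                 []         = []
All-strip b     ([] ∷ ws)          (_ ∷ pws)  = All-strip b ws pws
All-strip false ((false ∷ w) ∷ ws) (pw ∷ pws) = pw ∷ All-strip false ws pws
All-strip false ((true  ∷ w) ∷ ws) (_ ∷ pws)  = All-strip false ws pws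
All-strip true  ((false ∷ w) ∷ ws) (_ ∷ pws)  = All-strip true ws pws
All-strip true  ((true  ∷ w) ∷ ws) (pw ∷ pws) = pw ∷ All-strip true ws pws

incomparable-∷⁻ : ∀ {b v w} → Incomparable (b ∷ v) (b ∷ w) → Incomparable v w
incomparable-∷⁻ (v⋢w , w⋢v) = (v⋢w ∘ (refl ∷_)) , (w⋢v ∘ (refl ∷_))

incomparable-strip : ∀ b ws → AllPairs Incomparable ws → AllPairs Incomparable (strip b ws)
incomparable-strip b     []                 []              = []
incomparable-strip b     ([] ∷ ws)          (_ ∷ pairs)     = incomparable-strip b ws pairs
incomparable-strip false ((false ∷ w) ∷ ws) (incs ∷ pairs) =
  All.map incomparable-∷⁻ (All-strip false ws incs) ∷ incomparable-strip false ws pairs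
incomparable-strip false ((true  ∷ w) ∷ ws) (_ ∷ pairs)     = incomparable-strip false ws pairs
incomparable-strip true  ((false ∷ w) ∷ ws) (_ ∷ pairs)     = incomparable-strip true ws pairs
incomparable-strip true  ((true  ∷ w) ∷ ws) (incs ∷ pairs) =
  All.map incomparable-∷⁻ (All-strip true ws incs) ∷ incomparable-strip true ws pairs

weight : ℚ → List String → ℚ
weight x []       = 0ℚ
weight x (w ∷ ws) = x ℚ^.^ length w ℚ.+ weight x ws

weight-nonNeg : 0ℚ ℚ.≤ x → ∀ ws → 0ℚ ℚ.≤ weight x ws
weight-nonNeg 0≤x []       = ℚ.≤-refl
weight-nonNeg 0≤x (w ∷ ws) = +-nonNeg (^-nonNeg (length w) 0≤x) (weight-nonNeg 0≤x ws)

-- This recursion has the shape of the gale equation with `x` in place of 2⁻ˢ, so weights and gales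
-- can be compared by induction along the tree.
weight-strip : ∀ x ws → All (_≢ []) ws →
               weight x ws ≡ x ℚ.* (weight x (strip false ws) ℚ.+ weight x (strip true ws))
weight-strip x [] [] = sym (ℚ.*-zeroʳ x)
weight-strip x ([] ∷ ws) (w≢[] ∷ ne) = contradiction refl w≢[]
weight-strip x ((false ∷ w) ∷ ws) (_ ∷ ne) =
  trans (cong (x ℚ^.^ suc (length w) ℚ.+_) (weight-strip x ws ne))
    (identity x (x ℚ^.^ length w) (weight x (strip false ws)) (weight x (strip true ws)))
  where
  identity : ∀ x z a b → x ℚ.* z ℚ.+ x ℚ.* (a ℚ.+ b) ≡ x ℚ.* (z ℚ.+ a ℚ.+ b)
  identity = solve 4 (λ x z a b → x :* z :+ x :* (a :+ b) := x :* (z :+ a :+ b)) refl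
weight-strip x ((true ∷ w) ∷ ws) (_ ∷ ne) =
  trans (cong (x ℚ^.^ suc (length w) ℚ.+_) (weight-strip x ws ne))
    (identity x (x ℚ^.^ length w) (weight x (strip false ws)) (weight x (strip true ws)))
  where
  identity : ∀ x z a b → x ℚ.* z ℚ.+ x ℚ.* (a ℚ.+ b) ≡ x ℚ.* (a ℚ.+ (z ℚ.+ b))
  identity = solve 4 (λ x z a b → x :* z :+ x :* (a :+ b) := x :* (a :+ (z :+ b))) refl

-- Each string contributes at most r^|w| x^|w|, and r ≤ 1 with |w| ≥ k replaces r^|w| by the common
-- factor rᵏ.
weight-scale : ∀ {r} → 0ℚ ℚ.≤ r → r ℚ.≤ 1ℚ → 0ℚ ℚ.≤ x → 0ℚ ℚ.≤ y → y ℚ.≤ r ℚ.* x →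
               ∀ {ws} → All (λ w → k ℕ.≤ length w) ws → weight y ws ℚ.≤ r ℚ^.^ k ℚ.* weight x ws
weight-scale {k = k} {r} 0≤r r≤1 0≤x 0≤y y≤rx [] = ℚ.≤-reflexive (sym (ℚ.*-zeroʳ (r ℚ^.^ k)))
weight-scale {x} {y} {k} {r} 0≤r r≤1 0≤x 0≤y y≤rx {w ∷ ws} (k≤w ∷ k≤ws) = begin
  y ℚ^.^ l ℚ.+ weight y ws
    ≤⟨ ℚ.+-mono-≤ (begin
         y ℚ^.^ l                 ≤⟨ ^-mono l 0≤y y≤rx ⟩
         (r ℚ.* x) ℚ^.^ l         ≡⟨ ℚ^.^-distrib-* r x l ⟩
         r ℚ^.^ l ℚ.* x ℚ^.^ l    ≤⟨ *-monoʳ (^-nonNeg l 0≤x) (^-antitone 0≤r r≤1 k≤w) ⟩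
         r ℚ^.^ k ℚ.* x ℚ^.^ l    ∎)
       (weight-scale 0≤r r≤1 0≤x 0≤y y≤rx k≤ws) ⟩
  r ℚ^.^ k ℚ.* x ℚ^.^ l ℚ.+ r ℚ^.^ k ℚ.* weight x ws
    ≡⟨ ℚ.*-distribˡ-+ (r ℚ^.^ k) (x ℚ^.^ l) (weight x ws) ⟨
  r ℚ^.^ k ℚ.* (x ℚ^.^ l ℚ.+ weight x ws) ∎
  where
  open ℚ.≤-Reasoning
  l = length w

sum-upper : (z : ℝ≥0∞ 0ℓ) → 0ℚ ℚ.≤ x → z ≤ ι x → ∀ ws →
            foldr _+_ 0# (map (λ w → z ^ length w) ws) ≤ ι (weight x ws)
sum-upper z 0≤x z≤x []       = 0#-least (ι 0ℚ)
sum-upper z 0≤x z≤x (w ∷ ws) =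
  +-ι-upper (z ^ length w) (foldr _+_ 0# (map (λ w → z ^ length w) ws))
    (^-nonNeg (length w) 0≤x) (weight-nonNeg 0≤x ws)
    (^-ι-upper z 0≤x z≤x (length w)) (sum-upper z 0≤x z≤x ws)

sum-lower : (z : ℝ≥0∞ 0ℓ) → 0ℚ ℚ.≤ x → ι x ≤ z → ∀ ws →
            ι (weight x ws) ≤ foldr _+_ 0# (map (λ w → z ^ length w) ws)
sum-lower z 0≤x x≤z []       = ι-least 0# λ _ → inj₁
sum-lower z 0≤x x≤z (w ∷ ws) =
  +-ι-lower (z ^ length w) (foldr _+_ 0# (map (λ w → z ^ length w) ws))
    (^-ι-lower z 0≤x x≤z (length w)) (sum-lower z 0≤x x≤z ws)

module _ {s : ℝ≥0} {d : String → ℝ≥0} (gale : IsGale s d)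
         {σ : ℚ} (0≤σ : 0ℚ ℚ.≤ σ) (σ≤2^-s : ι σ ≤ 2^- s) where

  -- The induction moves the root u and the strings of ws one level down the tree.

  gale-kraft : ∀ n u ws → All (λ w → length w ℕ.< n) ws →
               AllPairs Incomparable ws → All (λ w → below (value (d (u ++ w))) 1ℚ) ws →
               ι (weight σ ws) ≤ value (d u)
  gale-kraft n u [] _ _ _ = ι-least (value (d u)) λ 0≤p p<0 →
    contradiction (ℚ.≤-<-trans 0≤p p<0) (ℚ.<-irrefl refl)
  gale-kraft zero u (w ∷ ws) (() ∷ _)
  gale-kraft (suc n) u ws@(_ ∷ _) short pairs large with incomparable-[] pairs
  -- Here the root `u` is itself the only string: its weight is 1, and 1 lies below d(u) by
  -- assumption.
  ... | inj₁ refl = ι-least (value (d u)) λ {p} _ p<1 → lower (value (d u))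
    (ℚ.<⇒≤ (subst (p ℚ.<_) (ℚ.+-identityʳ 1ℚ) p<1))
    (subst (λ w → below (value (d w)) 1ℚ) (List.++-identityʳ u) (All.head large))
  ... | inj₂ ne = proj₂ (gale u) ∘
    subst (λ p → ι p ≤ 2^- s * (d₀ + d₁)) (sym (weight-strip σ ws ne))
    (*-ι-lower (2^- s) (d₀ + d₁) 0≤σ
      (+-nonNeg (weight-nonNeg 0≤σ (strip false ws)) (weight-nonNeg 0≤σ (strip true ws)))
      σ≤2^-s (+-ι-lower d₀ d₁ (below-child false) (below-child true)))
    where
    d₀ = value (d (u ∷ʳ false))
    d₁ = value (d (u ∷ʳ true))
    below-child : ∀ b → ι (weight σ (strip b ws)) ≤ value (d (u ∷ʳ b))
    below-child b = gale-kraft n (u ∷ʳ b) (strip b ws)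
      (All.map ℕ.s≤s⁻¹ (All-strip b ws short)) (incomparable-strip b ws pairs)
      (All.map (λ {w} → subst (λ w → below (value (d w)) 1ℚ) (sym (List.∷ʳ-++ u b w)))
        (All-strip b ws large))

lengths-bounded : ∀ (ws : List String) → ∃[ n ] All (λ w → length w ℕ.< n) ws
lengths-bounded []       = 0 , []
lengths-bounded (w ∷ ws) =
  let n , ws<n = lengths-bounded ws
  in suc (length w) ℕ.⊔ n , ℕ.m≤m⊔n _ n ∷ All.map (λ v<n → ℕ.≤-trans v<n (ℕ.m≤n⊔m _ n)) ws<n

-- From gales to packing measures

module GaleToPacking {X : Pred Cantor 0ℓ} {s : ℝ≥0} {q : ℚ} (larger : LargerExponent s q)
         {d : String → ℝ≥0} (gale : IsGale s d)
         (succeeds : ∀ {S} → S ∈ X → SucceedsStronglyOn d S) where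
  open LargerExponent larger

  Xs : ℕ → Pred Cantor 0ℓ
  Xs i S = ∀ k → below (value (d (S ↾ (i ℕ.+ k)))) 1ℚ

  X⊆⋃Xs : X ⊆ ⋃ ℕ Xs
  X⊆⋃Xs {S} S∈X = ⨆⨅-above (proj₂ (succeeds S∈X) (inj₂ (1ℚ ℚ.+ 1ℚ , tt , p<p+1)))
    where
    ⨆⨅-above : below (liminf (λ n → value (d (S ↾ n)))) 1ℚ → ∃[ i ] Xs i S
    -- Each `⋁` contains the negative rationals by default; the first two cases exclude this origin
    -- for 1.
    ⨆⨅-above (inj₁ 1<0) = contradiction (ℚ.<-trans 1<0 0<1) (ℚ.<-irrefl refl)
    ⨆⨅-above (inj₂ (b , (n , inj₁ b<0) , 1<b)) =
      contradiction (ℚ.<-trans (ℚ.<-trans 1<b b<0) 0<1) (ℚ.<-irrefl refl)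
    ⨆⨅-above (inj₂ (b , (n , inj₂ (c , c<d , b<c)) , 1<b)) =
      n , λ k → lower (value (d (S ↾ (n ℕ.+ k)))) (ℚ.<⇒≤ (ℚ.<-trans 1<b b<c)) (c<d k)

  -- The 1 is added to make the bound on d(λ) positive, as `powers-vanish-*` requires.
  D : ℚ
  D = proj₁ (finite (d [])) ℚ.+ 1ℚ

  d[]≤D : ¬ below (value (d [])) D
  d[]≤D D<d[] = proj₂ (finite (d [])) (lower (value (d [])) (p≤p+q 0≤1) D<d[])

  0<D : 0ℚ ℚ.< D
  0<D = ℚ.≤-<-trans (ℚ.≮⇒≥ (proj₂ (finite (d [])) ∘ negative (value (d [])))) p<p+1

  0≤r = ℚ.<⇒≤ 0<r
  0≤σ = ℚ.<⇒≤ 0<σ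
  0≤β = ℚ.<⇒≤ 0<β

  β≤rσ : β ℚ.≤ r ℚ.* σ
  β≤rσ = *-monoˡ 0≤r (subst (r ℚ.* σ ℚ.≤_) (ℚ.*-identityˡ σ) (*-monoʳ 0≤σ (ℚ.<⇒≤ r<1)))

  -- The string `w` is an initial segment of some S in X_i, and |w| ≥ i, so the condition defining
  -- X_i applies at index |w| - i.
  long⇒large : ∀ {i k A w} → i ℕ.≤ k → 𝓑 k (Xs i) A → w ∈ A → below (value (d w)) 1ℚ
  long⇒large {i} {w = w} i≤k A∈𝓑 w∈A =
    let S , S↾w≡w , S∈Xᵢ = meets A∈𝓑 w∈A
        i≤w = ℕ.≤-trans i≤k (long A∈𝓑 w∈A)
    in subst (λ v → below (value (d v)) 1ℚ)
         (trans (cong (S ↾_) (ℕ.m+[n∸m]≡n i≤w)) S↾w≡w) (S∈Xᵢ (length w ℕ.∸ i))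

  -- ∑ β^|w| ≤ rᵏ ∑ σ^|w| ≤ rᵏ D, by `weight-scale` and then by `gale-kraft` at the root.
  Pₖ-bound : ∀ i k → i ℕ.≤ k → Pₖ k t (Xs i) ≤ ι (r ℚ^.^ k ℚ.* D)
  Pₖ-bound i k i≤k = ⋁-least (ι (r ℚ^.^ k ℚ.* D)) λ ((A , A∈𝓑) , b<∑) →
    ⋁-least (ι (r ℚ^.^ k ℚ.* D)) (λ ((ws , uniq , ws⊆A) , b<Σ) →
      below-ι⁺ (ℚ.<-≤-trans
        (below-ι⁻ (weight-nonNeg 0≤β ws) (sum-upper (2^- t) 0≤β 2^-t≤β ws b<Σ))
        (ℚ.≤-trans
          (weight-scale 0≤r (ℚ.<⇒≤ r<1) 0≤σ 0≤β β≤rσ (All.map (long A∈𝓑) ws⊆A))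
          (*-monoˡ (^-nonNeg k 0≤r) (ℚ.≮⇒≥ λ D<weight → d[]≤D
            (let n , ws<n = lengths-bounded ws in
             gale-kraft {s} {d} gale 0≤σ σ≤2^-s n [] ws ws<n
              (prefixSet⇒incomparable (prefixSet A∈𝓑) ws⊆A uniq)
              (All.map (long⇒large i≤k A∈𝓑) ws⊆A) (below-ι⁺ D<weight))))))) b<∑

  P∞≤0 : ∀ i → P∞ t (Xs i) ≤ 0#
  P∞≤0 i = ⋁-least 0# λ (n , b<⨅) → ⨅-≤0 n b<⨅
    where
    ≤0 : ∀ n c → (∀ k → below (Pₖ (n ℕ.+ k) t (Xs i)) c) → c ℚ.≤ 0ℚ
    ≤0 n c c<Pₖ = ℚ.≮⇒≥ λ 0<c →
      let m , rᵐD≤c = powers-vanish-* 0<r r<1 0<D 0<c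
          -- This index lies in the tail starting at `n`, is at least `m`, where rᵐD ≤ c, and is at
          -- least `i`, as `Pₖ-bound` demands.
          k = n ℕ.+ (m ℕ.+ i)
          i≤k = ℕ.≤-trans (ℕ.m≤n+m i m) (ℕ.m≤n+m (m ℕ.+ i) n)
          m≤k = ℕ.≤-trans (ℕ.m≤m+n m i) (ℕ.m≤n+m (m ℕ.+ i) n)
          0≤D = ℚ.<⇒≤ 0<D
          c<rᵏD = below-ι⁻ (*-nonNeg (^-nonNeg k 0≤r) 0≤D) (Pₖ-bound i k i≤k (c<Pₖ (m ℕ.+ i)))
          rᵏD≤rᵐD = *-monoʳ 0≤D (^-antitone 0≤r (ℚ.<⇒≤ r<1) m≤k)
      in ℚ.<-irrefl refl (ℚ.<-≤-trans c<rᵏD (ℚ.≤-trans rᵏD≤rᵐD rᵐD≤c))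

    ⨅-≤0 : ∀ n → ⨅ (λ k → Pₖ (n ℕ.+ k) t (Xs i)) ≤ 0#
    ⨅-≤0 n (inj₁ b<0) = inj₁ b<0
    ⨅-≤0 n (inj₂ (c , c<Pₖ , b<c)) = inj₁ (ℚ.<-≤-trans b<c (≤0 n c c<Pₖ))

  P≈0 : P t X ≈ 0#
  P≈0 = (λ q<P → series-≤0 (λ i → P∞ t (Xs i)) P∞≤0
          (below-⨅ (λ ((Ys , _) : Σ[ Ys ∈ (ℕ → Pred Cantor 0ℓ) ] X ⊆ ⋃ ℕ Ys) →
              series λ i → P∞ t (Ys i))
            (Xs , λ {S} → X⊆⋃Xs {S}) q<P)) ,
        0#-least (P t X)

-- Rational gales

sumTo : ℕ → (ℕ → ℚ) → ℚ
sumTo zero    f = 0ℚ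
sumTo (suc n) f = sumTo n f ℚ.+ f n

sumTo-nonNeg : ∀ {f} → (∀ i → 0ℚ ℚ.≤ f i) → ∀ n → 0ℚ ℚ.≤ sumTo n f
sumTo-nonNeg 0≤f zero    = ℚ.≤-refl
sumTo-nonNeg 0≤f (suc n) = +-nonNeg (sumTo-nonNeg 0≤f n) (0≤f n)

sumTo-mono : ∀ {f g} → (∀ i → f i ℚ.≤ g i) → ∀ n → sumTo n f ℚ.≤ sumTo n g
sumTo-mono f≤g zero    = ℚ.≤-refl
sumTo-mono f≤g (suc n) = ℚ.+-mono-≤ (sumTo-mono f≤g n) (f≤g n)

sumTo-monoˡ : ∀ {f} → (∀ i → 0ℚ ℚ.≤ f i) → m ℕ.≤ n → sumTo m f ℚ.≤ sumTo n f
sumTo-monoˡ {n = n} 0≤f m≤n = go (ℕ.≤⇒≤′ m≤n)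
  where
  go : ∀ {n} → m ℕ.≤′ n → sumTo m _ ℚ.≤ sumTo n _
  go (ℕ.≤′-reflexive refl) = ℚ.≤-refl
  go (ℕ.≤′-step m≤n)       = ℚ.≤-trans (go m≤n) (p≤p+q (0≤f _))

sumTo-term : ∀ {f i n} → (∀ i → 0ℚ ℚ.≤ f i) → i ℕ.< n → f i ℚ.≤ sumTo n f
sumTo-term {f} {i} 0≤f i<n = ℚ.≤-trans (p≤q+p (sumTo-nonNeg 0≤f i)) (sumTo-monoˡ 0≤f i<n)

sumTo-*ʳ : ∀ f c n → sumTo n (λ i → f i ℚ.* c) ≡ sumTo n f ℚ.* c
sumTo-*ʳ f c zero    = sym (ℚ.*-zeroˡ c)
sumTo-*ʳ f c (suc n) =
  trans (cong (ℚ._+ f n ℚ.* c) (sumTo-*ʳ f c n)) (sym (ℚ.*-distribʳ-+ c (sumTo n f) (f n)))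

-- Any K with K(1 - r) ≥ 1 works: then 1 + rK ≤ K, which preserves the invariant that the n-th
-- partial sum plus rⁿK is at most K.
geometric-bounded : ∀ {r} → 0ℚ ℚ.< r → r ℚ.< 1ℚ →
                    ∃[ K ] 0ℚ ℚ.≤ K × (∀ n → sumTo n (r ℚ^.^_) ℚ.≤ K)
geometric-bounded {r} 0<r r<1 =
  let m , 1≤mδ = archimedean (p<q⇒0<q-p r<1) 1ℚ in bound (fromℕ m) (fromℕ-nonNeg m) 1≤mδ
  where
  open ℚ.≤-Reasoning
  bound : ∀ K → 0ℚ ℚ.≤ K → 1ℚ ℚ.≤ K ℚ.* (1ℚ ℚ.- r) →
          ∃[ K ] 0ℚ ℚ.≤ K × (∀ n → sumTo n (r ℚ^.^_) ℚ.≤ K)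
  bound K 0≤K 1≤Kδ = K , 0≤K ,
    λ n → ℚ.≤-trans (p≤p+q (*-nonNeg (^-nonNeg n (ℚ.<⇒≤ 0<r)) 0≤K)) (go n)
    where
    1+rK≤K : 1ℚ ℚ.+ r ℚ.* K ℚ.≤ K
    1+rK≤K = begin
      1ℚ ℚ.+ r ℚ.* K                     ≤⟨ ℚ.+-monoˡ-≤ (r ℚ.* K) 1≤Kδ ⟩
      K ℚ.* (1ℚ ℚ.- r) ℚ.+ r ℚ.* K       ≡⟨ cong (K ℚ.* (1ℚ ℚ.- r) ℚ.+_) (ℚ.*-comm r K) ⟩
      K ℚ.* (1ℚ ℚ.- r) ℚ.+ K ℚ.* r       ≡⟨ ℚ.*-distribˡ-+ K (1ℚ ℚ.- r) r ⟨
      K ℚ.* (1ℚ ℚ.- r ℚ.+ r)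
        ≡⟨ cong (K ℚ.*_) (trans (ℚ.+-comm (1ℚ ℚ.- r) r) (p+[q-p]≡q r 1ℚ)) ⟩
      K ℚ.* 1ℚ                           ≡⟨ ℚ.*-identityʳ K ⟩
      K                                  ∎
    regroup : ∀ s z → s ℚ.+ z ℚ.+ r ℚ.* z ℚ.* K ≡ s ℚ.+ z ℚ.* (1ℚ ℚ.+ r ℚ.* K)
    regroup s z =
      solve 4 (λ s z r K → s :+ z :+ r :* z :* K := s :+ z :* (con 1ℚ :+ r :* K)) refl s z r K
    go : ∀ n → sumTo n (r ℚ^.^_) ℚ.+ r ℚ^.^ n ℚ.* K ℚ.≤ K
    go zero    = ℚ.≤-reflexive (trans (ℚ.+-identityˡ (1ℚ ℚ.* K)) (ℚ.*-identityˡ K))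
    go (suc n) = begin
      sumTo n (r ℚ^.^_) ℚ.+ r ℚ^.^ n ℚ.+ r ℚ.* r ℚ^.^ n ℚ.* K
        ≡⟨ regroup (sumTo n (r ℚ^.^_)) (r ℚ^.^ n) ⟩
      sumTo n (r ℚ^.^_) ℚ.+ r ℚ^.^ n ℚ.* (1ℚ ℚ.+ r ℚ.* K)
        ≤⟨ ℚ.+-monoʳ-≤ (sumTo n (r ℚ^.^_)) (*-monoˡ (^-nonNeg n (ℚ.<⇒≤ 0<r)) 1+rK≤K) ⟩
      sumTo n (r ℚ^.^_) ℚ.+ r ℚ^.^ n ℚ.* K                        ≤⟨ go n ⟩
      K                                                           ∎

*-distrib-swap : ∀ c b x y → c ℚ.* (b ℚ.* (x ℚ.+ y)) ≡ b ℚ.* (c ℚ.* x ℚ.+ c ℚ.* y)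
*-distrib-swap = solve 4 (λ c b x y → c :* (b :* (x :+ y)) := b :* (c :* x :+ c :* y)) refl

record RationalGale (β : ℚ) (f : String → ℚ) : Set where
  field
    nonNeg : ∀ w → 0ℚ ℚ.≤ f w
    step   : ∀ w → f w ≡ β ℚ.* (f (w ∷ʳ false) ℚ.+ f (w ∷ʳ true))
open RationalGale

module _ {β : ℚ} where

  0-gale : RationalGale β (λ _ → 0ℚ)
  0-gale .nonNeg _ = ℚ.≤-refl
  0-gale .step _   = sym (ℚ.*-zeroʳ β)

  +-gale : ∀ {f g} → RationalGale β f → RationalGale β g → RationalGale β (λ w → f w ℚ.+ g w)
  +-gale F G .nonNeg w = +-nonNeg (F .nonNeg w) (G .nonNeg w)
  +-gale {f} {g} F G .step w = trans (cong₂ ℚ._+_ (F .step w) (G .step w))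
    (regroup β (f (w ∷ʳ false)) (f (w ∷ʳ true)) (g (w ∷ʳ false)) (g (w ∷ʳ true)))
    where
    regroup : ∀ b x y z w → b ℚ.* (x ℚ.+ y) ℚ.+ b ℚ.* (z ℚ.+ w) ≡ b ℚ.* (x ℚ.+ z ℚ.+ (y ℚ.+ w))
    regroup =
      solve 5 (λ b x y z w → b :* (x :+ y) :+ b :* (z :+ w) := b :* (x :+ z :+ (y :+ w))) refl

  *-gale : ∀ {c f} → 0ℚ ℚ.≤ c → RationalGale β f → RationalGale β (λ w → c ℚ.* f w)
  *-gale 0≤c F .nonNeg w = *-nonNeg 0≤c (F .nonNeg w)
  *-gale {c} {f} 0≤c F .step w = trans (cong (c ℚ.*_) (F .step w))
    (*-distrib-swap c β (f (w ∷ʳ false)) (f (w ∷ʳ true)))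

  sumTo-gale : ∀ {f : ℕ → String → ℚ} → (∀ i → RationalGale β (f i)) →
               ∀ n → RationalGale β (λ w → sumTo n (λ i → f i w))
  sumTo-gale F zero    = 0-gale
  sumTo-gale F (suc n) = +-gale (sumTo-gale F n) (F n)

  -- Since the sibling's value is nonnegative, one step down the tree multiplies a gale by at most
  -- 1/β. A bound at the root thereby becomes a bound at every string.
  gale-growth : ∀ {f} → 0ℚ ℚ.≤ β → RationalGale β f → ∀ w → β ℚ^.^ length w ℚ.* f w ℚ.≤ f []
  gale-growth {f} 0≤β F [] = ℚ.≤-reflexive (ℚ.*-identityˡ (f []))
  gale-growth {f} 0≤β F (b ∷ w) = begin
    β ℚ.* β ℚ^.^ length w ℚ.* f (b ∷ w)     ≡⟨ ℚ.*-assoc β (β ℚ^.^ length w) (f (b ∷ w)) ⟩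
    β ℚ.* (β ℚ^.^ length w ℚ.* f (b ∷ w))   ≤⟨ *-monoˡ 0≤β (gale-growth 0≤β subgale w) ⟩
    β ℚ.* f (b ∷ [])                        ≤⟨ *-monoˡ 0≤β (child b) ⟩
    β ℚ.* (f (false ∷ []) ℚ.+ f (true ∷ [])) ≡⟨ F .step [] ⟨
    f []                                    ∎
    where
    open ℚ.≤-Reasoning
    subgale : RationalGale β (f ∘ (b ∷_))
    subgale .nonNeg w = F .nonNeg (b ∷ w)
    subgale .step w   = F .step (b ∷ w)
    child : ∀ b → f (b ∷ []) ℚ.≤ f (false ∷ []) ℚ.+ f (true ∷ [])
    child false = p≤p+q (F .nonNeg _)
    child true  = p≤q+p (F .nonNeg _)

-- `h` is 1/(2β), the factor per bit of a gale that splits its value evenly between both children.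
module Pointed {β h : ℚ} (0≤β : 0ℚ ℚ.≤ β) (0≤h : 0ℚ ℚ.≤ h) (β[h+h]≡1 : β ℚ.* (h ℚ.+ h) ≡ 1ℚ) where

  -- The gale that is 1 at v and 0 at the strings that are incomparable to v.

  pointed : String → String → ℚ
  pointed []          []          = 1ℚ
  pointed []          (_ ∷ w)     = h ℚ.* pointed [] w
  pointed (_ ∷ v)     []          = β ℚ.* pointed v []
  pointed (false ∷ v) (false ∷ w) = pointed v w
  pointed (false ∷ v) (true ∷ w)  = 0ℚ
  pointed (true ∷ v)  (false ∷ w) = 0ℚ
  pointed (true ∷ v)  (true ∷ w)  = pointed v w

  pointed-gale : ∀ v → RationalGale β (pointed v)
  pointed-gale v .nonNeg = go v
    where
    go : ∀ v w → 0ℚ ℚ.≤ pointed v w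
    go []          []          = 0≤1
    go []          (_ ∷ w)     = *-nonNeg 0≤h (go [] w)
    go (_ ∷ v)     []          = *-nonNeg 0≤β (go v [])
    go (false ∷ v) (false ∷ w) = go v w
    go (false ∷ v) (true ∷ w)  = ℚ.≤-refl
    go (true ∷ v)  (false ∷ w) = ℚ.≤-refl
    go (true ∷ v)  (true ∷ w)  = go v w
  pointed-gale v .step = go v
    where
    go : ∀ v w → pointed v w ≡ β ℚ.* (pointed v (w ∷ʳ false) ℚ.+ pointed v (w ∷ʳ true))
    go []          []          =
      sym (trans (cong (β ℚ.*_) (cong₂ ℚ._+_ (ℚ.*-identityʳ h) (ℚ.*-identityʳ h))) β[h+h]≡1)
    go []          (_ ∷ w)     = trans (cong (h ℚ.*_) (go [] w))
      (*-distrib-swap h β (pointed [] (w ∷ʳ false)) (pointed [] (w ∷ʳ true)))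
    go (false ∷ v) []          = cong (β ℚ.*_) (sym (ℚ.+-identityʳ _))
    go (true ∷ v)  []          = cong (β ℚ.*_) (sym (ℚ.+-identityˡ _))
    go (false ∷ v) (false ∷ w) = go v w
    go (false ∷ v) (true ∷ w)  = 0-gale {β} .step w
    go (true ∷ v)  (false ∷ w) = 0-gale {β} .step w
    go (true ∷ v)  (true ∷ w)  = go v w

  pointed-self : ∀ v → pointed v v ≡ 1ℚ
  pointed-self []          = refl
  pointed-self (false ∷ v) = pointed-self v
  pointed-self (true ∷ v)  = pointed-self v

  pointed-root : ∀ v → pointed v [] ≡ β ℚ^.^ length v
  pointed-root []      = refl
  pointed-root (_ ∷ v) = cong (β ℚ.*_) (pointed-root v)

  pointedSum : List String → String → ℚ
  pointedSum []       w = 0ℚ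
  pointedSum (v ∷ vs) w = pointed v w ℚ.+ pointedSum vs w

  pointedSum-gale : ∀ vs → RationalGale β (pointedSum vs)
  pointedSum-gale []       = 0-gale
  pointedSum-gale (v ∷ vs) = +-gale (pointed-gale v) (pointedSum-gale vs)

  pointedSum-root : ∀ vs → pointedSum vs [] ≡ weight β vs
  pointedSum-root []       = refl
  pointedSum-root (v ∷ vs) = cong₂ ℚ._+_ (pointed-root v) (pointedSum-root vs)

  pointedSum-∈ : ∀ {v vs} → v ∈ₗ vs → 1ℚ ℚ.≤ pointedSum vs v
  pointedSum-∈ {v} {vs = v′ ∷ vs} (here refl) =
    ℚ.≤-trans (ℚ.≤-reflexive (sym (pointed-self v))) (p≤p+q (pointedSum-gale vs .nonNeg v))
  pointedSum-∈ {v} {vs = v′ ∷ vs} (there v∈vs) =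
    ℚ.≤-trans (pointedSum-∈ v∈vs) (p≤q+p (pointed-gale v′ .nonNeg v))

-- Suprema of increasing sequences of rational gales.

supGale : (G : ℕ → String → ℚ) → String → ℝ≥0∞ 0ℓ
supGale G w = ⋁ λ q → ∃[ n ] q ≡ G n w

module _ {β : ℚ} (G : ℕ → String → ℚ) (G-gale : ∀ n → RationalGale β (G n))
         (G-mono : ∀ w {m n} → m ℕ.≤ n → G m w ℚ.≤ G n w) where

  supGale-above : ∀ {w p} → below (supGale G w) p → ∃[ n ] p ℚ.< G n w
  supGale-above {w} (inj₁ p<0)                   = 0 , ℚ.<-≤-trans p<0 (G-gale 0 .nonNeg w)
  supGale-above     (inj₂ (_ , (n , refl) , p<G)) = n , p<G

  ι≤supGale : ∀ n w → ι (G n w) ≤ supGale G w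
  ι≤supGale n w = ι-least (supGale G w) λ _ p<G → inj₂ (G n w , (n , refl) , p<G)

  -- By `gale-growth` all G n w are at most B β^(-|w|), and `fromℕ l` is chosen above that number.
  supGale-finite : 0ℚ ℚ.< β → ∀ {B} → (∀ n → G n [] ℚ.≤ B) → ∀ w → ∃[ q ] ¬ below (supGale G w) q
  supGale-finite 0<β {B} G≤B w =
    let l , B≤lβʷ = archimedean (^-pos (length w) 0<β) B
    in fromℕ l , λ l<G → let n , l<Gₙ = supGale-above l<G in
      ℚ.<-irrefl refl (ℚ.<-≤-trans l<Gₙ (*-cancelˡ (^-pos (length w) 0<β) (begin
        β ℚ^.^ length w ℚ.* G n w        ≤⟨ gale-growth (ℚ.<⇒≤ 0<β) (G-gale n) w ⟩
        G n []                           ≤⟨ G≤B n ⟩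
        B                                ≤⟨ B≤lβʷ ⟩
        fromℕ l ℚ.* β ℚ^.^ length w      ≡⟨ ℚ.*-comm (fromℕ l) (β ℚ^.^ length w) ⟩
        β ℚ^.^ length w ℚ.* fromℕ l      ∎)))
    where open ℚ.≤-Reasoning

  -- Each `G n` satisfies the equation exactly. Monotonicity in `n` lets a single index approximate
  -- the suprema at both children at once.
  supGale-step : 0ℚ ℚ.≤ β → (z : ℝ≥0∞ 0ℓ) → ι β ≤ z → z ≤ ι β → ∀ w →
                 supGale G w ≈ z * (supGale G (w ∷ʳ false) + supGale G (w ∷ʳ true))
  supGale-step 0≤β z β≤z z≤β w = to , from
    where
    d₀ = supGale G (w ∷ʳ false)
    d₁ = supGale G (w ∷ʳ true)
    G₀ = λ n → G n (w ∷ʳ false)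
    G₁ = λ n → G n (w ∷ʳ true)

    to : supGale G w ≤ z * (d₀ + d₁)
    to (inj₁ q<0) = negative (z * (d₀ + d₁)) q<0
    to (inj₂ (_ , (n , refl) , q<G)) = subst (λ g → ι g ≤ z * (d₀ + d₁)) (sym (G-gale n .step w))
      (*-ι-lower z (d₀ + d₁) 0≤β
        (+-nonNeg (G-gale n .nonNeg (w ∷ʳ false)) (G-gale n .nonNeg (w ∷ʳ true)))
        β≤z
        (+-ι-lower d₀ d₁ (ι≤supGale n (w ∷ʳ false)) (ι≤supGale n (w ∷ʳ true))))
      (below-ι⁺ q<G)

    from : z * (d₀ + d₁) ≤ supGale G w
    from = ⋁-least (supGale G w) λ {
      (p , q , 0≤p , p<z , 0≤q , q<d₀+d₁ , refl) → product 0≤p 0≤q p<z q<d₀+d₁ }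
      where
      sum : ∀ {q} → 0ℚ ℚ.≤ q → below (d₀ + d₁) q → ∃[ n ] q ℚ.< G₀ n ℚ.+ G₁ n
      sum 0≤q (inj₁ q<0) = contradiction (ℚ.≤-<-trans 0≤q q<0) (ℚ.<-irrefl refl)
      sum 0≤q (inj₂ (_ , (a , b , a<d₀ , b<d₁ , refl) , q<a+b)) =
        let m , a<G₀ = supGale-above a<d₀
            n , b<G₁ = supGale-above b<d₁
        in m ℕ.⊔ n , ℚ.<-trans q<a+b (ℚ.+-mono-<
             (ℚ.<-≤-trans a<G₀ (G-mono (w ∷ʳ false) (ℕ.m≤m⊔n m n)))
             (ℚ.<-≤-trans b<G₁ (G-mono (w ∷ʳ true) (ℕ.m≤n⊔m m n))))
      product : ∀ {p q} → 0ℚ ℚ.≤ p → 0ℚ ℚ.≤ q → below z p → below (d₀ + d₁) q →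
                below (supGale G w) (p ℚ.* q)
      product {p} {q} 0≤p 0≤q p<z q<d₀+d₁ =
        let n , q<G₀+G₁ = sum 0≤q q<d₀+d₁
            p<β = below-ι⁻ 0≤β (z≤β p<z)
        in inj₂ (G n w , (n , refl) , subst (p ℚ.* q ℚ.<_) (sym (G-gale n .step w))
             (ℚ.≤-<-trans (*-monoʳ 0≤q (ℚ.<⇒≤ p<β))
               (*-monoˡ-< (ℚ.≤-<-trans 0≤p p<β) q<G₀+G₁)))

-- Strings of a given length.

strings : ℕ → List String
strings zero    = [] ∷ []
strings (suc n) = map (false ∷_) (strings n) ++ map (true ∷_) (strings n)

strings-complete : ∀ w → w ∈ₗ strings (length w)
strings-complete []          = here refl
strings-complete (false ∷ w) = ∈ₗ.∈-++⁺ˡ (∈ₗ.∈-map⁺ (false ∷_) (strings-complete w))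
strings-complete (true ∷ w)  =
  ∈ₗ.∈-++⁺ʳ (map (false ∷_) (strings (length w))) (∈ₗ.∈-map⁺ (true ∷_) (strings-complete w))

strings-length : ∀ n → All (λ w → length w ≡ n) (strings n)
strings-length zero    = refl ∷ []
strings-length (suc n) = All.++⁺ (All.map⁺ (All.map (cong suc) (strings-length n)))
                                 (All.map⁺ (All.map (cong suc) (strings-length n)))

strings-unique : ∀ n → Unique (strings n)
strings-unique zero    = [] ∷ []
strings-unique (suc n) = Unique.++⁺ (Unique.map⁺ List.∷-injectiveʳ (strings-unique n))
  (Unique.map⁺ List.∷-injectiveʳ (strings-unique n)) disjoint
  where
  disjoint : ∀ {w} → ¬ (w ∈ₗ map (false ∷_) (strings n) × w ∈ₗ map (true ∷_) (strings n))
  disjoint (w∈f , w∈t) with ∈ₗ.∈-map⁻ (false ∷_) w∈f | ∈ₗ.∈-map⁻ (true ∷_) w∈t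
  ... | _ , _ , refl | _ , _ , ()

-- This makes every set of strings of one common length a prefix set.
prefix-length⇒≡ : ∀ {v w : String} → length v ≡ length w → Prefix _≡_ v w → v ≡ w
prefix-length⇒≡ {w = []}    _ []           = refl
prefix-length⇒≡ {w = _ ∷ _} () []
prefix-length⇒≡ eq (refl ∷ pre) = cong (_ ∷_) (prefix-length⇒≡ (ℕ.suc-injective eq) pre)

-- From packing measures to gales

module PackingToGale (em : ExcludedMiddle (lsuc 0ℓ)) {X : Pred Cantor 0ℓ} {s : ℝ≥0} {q : ℚ}
         (larger : LargerExponent s q) (P≈0 : P s X ≈ 0#) where
  open Classical em
  open LargerExponent larger
  open RationalGale

  Cover : Set₁
  Cover = Σ[ Ys ∈ (ℕ → Pred Cantor 0ℓ) ] X ⊆ ⋃ ℕ Ys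

  -- Otherwise 1 would lie below the sum of every cover, hence ½ below the infimum `P s X`, which is
  -- 0.
  small-cover : Σ[ c ∈ Cover ] ¬ below (series λ i → P∞ s (proj₁ c i)) 1ℚ
  small-cover = decidable-stable em λ none →
    ℚ.<-asym 0<½ (below-0#⁻ (proj₁ P≈0
      (inj₂ (1ℚ , (λ c → decidable-stable em λ small → none (c , small)) , ½<1))))

  Xs : ℕ → Pred Cantor 0ℓ
  Xs = proj₁ (proj₁ small-cover)

  P∞-small : ∀ i → ¬ below (P∞ s (Xs i)) 1ℚ
  P∞-small i 1<P∞ = proj₂ small-cover (term≤series (λ i → P∞ s (Xs i)) i 1<P∞)

  -- If 2 lay below every Pₖ, then 1 would lie below their limit. Raising the bound from 1 to 2
  -- leaves room for the strict inequalities of the nested infimum and supremum.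
  Pₖ-small : ∀ i → ∃[ k ] ¬ below (Pₖ k s (Xs i)) 2ℚ
  Pₖ-small i = decidable-stable em λ none → P∞-small i
    (let b , 1<b , b<2 = ℚ.<-dense {1ℚ} {2ℚ} p<p+1
     in inj₂ (b , (0 ,
          inj₂ (2ℚ , (λ k → decidable-stable em λ small → none (k , small)) , b<2)) , 1<b))

  threshold : ℕ → ℕ
  threshold i = proj₁ (Pₖ-small i)

  -- The length condition empties the levels below the threshold, so `level-weight` holds for every
  -- `n`.
  Touches : ℕ → Pred String 0ℓ
  Touches i w = threshold i ℕ.≤ length w × (∃[ S ] S ∈ Cylinder w × S ∈ Xs i)

  touches? : ∀ i w → Dec (Touches i w)
  touches? i w = em₀

  level : ℕ → ℕ → List String
  level i n = filter (touches? i) (strings n)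

  0≤r = ℚ.<⇒≤ 0<r
  0≤σ = ℚ.<⇒≤ 0<σ
  0≤β = ℚ.<⇒≤ 0<β

  level-length : ∀ i n → All (λ w → length w ≡ n) (level i n)
  level-length i n = All.filter⁺ (touches? i) (strings-length n)

  level-weight : ∀ i n → weight σ (level i n) ℚ.≤ 2ℚ
  level-weight i n = ℚ.≮⇒≥ λ 2<W → proj₂ (Pₖ-small i)
    -- Two intermediate rationals are needed because Pₖ is a supremum over prefix sets of suprema
    -- over finite lists.
    (let b , 2<b , b<W = ℚ.<-dense 2<W
         c , b<c , c<W = ℚ.<-dense b<W
     in inj₂ (b , ((A , A∈𝓑) ,
          inj₂ (c , ((level i n , uniq , level⊆A) ,
            sum-lower (2^- s) 0≤σ σ≤2^-s (level i n) (below-ι⁺ c<W)) , b<c)) , 2<b))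
    where
    A : Pred String 0ℓ
    A w = length w ≡ n × Touches i w
    A∈𝓑 : 𝓑 (threshold i) (Xs i) A
    A∈𝓑 = record
      { prefixSet = λ (u≡n , _) (v≡n , _) → prefix-length⇒≡ (trans u≡n (sym v≡n))
      ; long      = λ (_ , k≤w , _) → k≤w
      ; meets     = λ (_ , _ , meets) → meets
      }
    uniq : Unique (level i n)
    uniq = Unique.filter⁺ (touches? i) (strings-unique n)
    level⊆A : All A (level i n)
    level⊆A = All.zip (level-length i n , All.all-filter (touches? i) (strings n))

  instance
    r-pos = ℚ.positive 0<r
    r≢0 = ℚ.pos⇒nonZero r
    β-pos = ℚ.positive 0<β
    β≢0 = ℚ.pos⇒nonZero β

  h : ℚ
  h = ½ ℚ.* ℚ.1/ β

  0≤h : 0ℚ ℚ.≤ h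
  0≤h = *-nonNeg 0≤½ (ℚ.<⇒≤ (ℚ.positive⁻¹ (ℚ.1/ β) {{ℚ.1/pos⇒pos β}}))

  β[h+h]≡1 : β ℚ.* (h ℚ.+ h) ≡ 1ℚ
  β[h+h]≡1 = trans
    (cong (β ℚ.*_) (trans (sym (ℚ.*-distribʳ-+ (ℚ.1/ β) ½ ½)) (ℚ.*-identityˡ (ℚ.1/ β))))
    (ℚ.*-inverseʳ β)

  open Pointed {β} {h} 0≤β 0≤h β[h+h]≡1

  -- `γ` is 1/r, written as 1 plus a positive number to match the form of the base in
  -- `powers-unbounded`.
  γ-1 : ℚ
  γ-1 = ℚ.1/ r ℚ.- 1ℚ

  γ : ℚ
  γ = 1ℚ ℚ.+ γ-1

  γr≡1 : γ ℚ.* r ≡ 1ℚ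
  γr≡1 = trans (cong (ℚ._* r) (p+[q-p]≡q 1ℚ (ℚ.1/ r))) (ℚ.*-inverseˡ r)

  0<γ-1 : 0ℚ ℚ.< γ-1
  0<γ-1 = p<q⇒0<q-p {1ℚ} {ℚ.1/ r} (ℚ.*-cancelʳ-<-nonNeg r {{ℚ.pos⇒nonNeg r}}
    (subst₂ ℚ._<_ (sym (ℚ.*-identityˡ r)) (sym (ℚ.*-inverseˡ r)) r<1))

  1≤γ : 1ℚ ℚ.≤ γ
  1≤γ = p≤p+q (ℚ.<⇒≤ 0<γ-1)

  0≤γ : 0ℚ ℚ.≤ γ
  0≤γ = ℚ.≤-trans 0≤1 1≤γ

  γⁿrⁿ≡1 : ∀ n → γ ℚ^.^ n ℚ.* r ℚ^.^ n ≡ 1ℚ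
  γⁿrⁿ≡1 n = trans (sym (ℚ^.^-distrib-* γ r n)) (trans (cong (ℚ^._^ n) γr≡1) (1^n≡1 n))

  coefficient : ℕ → ℕ → ℚ
  coefficient i n = r ℚ^.^ i ℚ.* γ ℚ^.^ n

  coefficient-nonNeg : ∀ i n → 0ℚ ℚ.≤ coefficient i n
  coefficient-nonNeg i n = *-nonNeg (^-nonNeg i 0≤r) (^-nonNeg n 0≤γ)

  summand : ℕ → ℕ → String → ℚ
  summand n i w = coefficient i n ℚ.* pointedSum (level i n) w

  g : ℕ → String → ℚ
  g n w = sumTo (suc n) (λ i → summand n i w)

  G : ℕ → String → ℚ
  G N w = sumTo N (λ n → g n w)

  summand-gale : ∀ n i → RationalGale β (summand n i)
  summand-gale n i = *-gale (coefficient-nonNeg i n) (pointedSum-gale (level i n))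

  g-gale : ∀ n → RationalGale β (g n)
  g-gale n = sumTo-gale (summand-gale n) (suc n)

  G-gale : ∀ N → RationalGale β (G N)
  G-gale = sumTo-gale g-gale

  G-mono : ∀ w {m n} → m ℕ.≤ n → G m w ℚ.≤ G n w
  G-mono w = sumTo-monoˡ (λ n → g-gale n .nonNeg w)

  -- The weight for β = r²σ is at most r²ⁿ times the weight for `σ`, hence at most 2r²ⁿ; the
  -- coefficient γⁿ = r⁻ⁿ cancels one of the two factors rⁿ.
  summand-root : ∀ n i → summand n i [] ℚ.≤ r ℚ^.^ i ℚ.* (r ℚ^.^ n ℚ.* 2ℚ)
  summand-root n i = begin
    coefficient i n ℚ.* pointedSum (level i n) []
      ≡⟨ cong (coefficient i n ℚ.*_) (pointedSum-root (level i n)) ⟩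
    coefficient i n ℚ.* weight β (level i n)
      ≤⟨ *-monoˡ (coefficient-nonNeg i n) (ℚ.≤-trans
           (weight-scale {k = n} (*-nonNeg 0≤r 0≤r) rr≤1 0≤σ 0≤β
             (ℚ.≤-reflexive (sym (ℚ.*-assoc r r σ)))
             (All.map (ℕ.≤-reflexive ∘ sym) (level-length i n)))
           (*-monoˡ (^-nonNeg n (*-nonNeg 0≤r 0≤r)) (level-weight i n))) ⟩
    coefficient i n ℚ.* ((r ℚ.* r) ℚ^.^ n ℚ.* 2ℚ)
      ≡⟨ cong (λ z → coefficient i n ℚ.* (z ℚ.* 2ℚ)) (ℚ^.^-distrib-* r r n) ⟩
    r ℚ^.^ i ℚ.* γ ℚ^.^ n ℚ.* (r ℚ^.^ n ℚ.* r ℚ^.^ n ℚ.* 2ℚ)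
      ≡⟨ regroup (r ℚ^.^ i) (γ ℚ^.^ n) (r ℚ^.^ n) 2ℚ ⟩
    r ℚ^.^ i ℚ.* (γ ℚ^.^ n ℚ.* r ℚ^.^ n ℚ.* (r ℚ^.^ n ℚ.* 2ℚ))
      ≡⟨ cong (λ z → r ℚ^.^ i ℚ.* (z ℚ.* (r ℚ^.^ n ℚ.* 2ℚ))) (γⁿrⁿ≡1 n) ⟩
    r ℚ^.^ i ℚ.* (1ℚ ℚ.* (r ℚ^.^ n ℚ.* 2ℚ))
      ≡⟨ cong (r ℚ^.^ i ℚ.*_) (ℚ.*-identityˡ (r ℚ^.^ n ℚ.* 2ℚ)) ⟩
    r ℚ^.^ i ℚ.* (r ℚ^.^ n ℚ.* 2ℚ) ∎
    where
    open ℚ.≤-Reasoning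
    rr≤1 : r ℚ.* r ℚ.≤ 1ℚ
    rr≤1 = ℚ.≤-trans (*-mono 0≤r 0≤1 (ℚ.<⇒≤ r<1) (ℚ.<⇒≤ r<1)) (ℚ.≤-reflexive (ℚ.*-identityˡ 1ℚ))
    regroup : ∀ a b c e → a ℚ.* b ℚ.* (c ℚ.* c ℚ.* e) ≡ a ℚ.* (b ℚ.* c ℚ.* (c ℚ.* e))
    regroup = solve 4 (λ a b c e → a :* b :* (c :* c :* e) := a :* (b :* c :* (c :* e))) refl

  -- The double sum of 2rⁱrⁿ is bounded first over `i` and then over `n`, both times by the bound
  -- `K` of the geometric series.
  G-bounded : ∃[ B ] (∀ N → G N [] ℚ.≤ B)
  G-bounded = let K , 0≤K , geo≤K = geometric-bounded 0<r r<1 in bound K 0≤K geo≤K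
    where
    open ℚ.≤-Reasoning
    bound : ∀ K → 0ℚ ℚ.≤ K → (∀ n → sumTo n (r ℚ^.^_) ℚ.≤ K) → ∃[ B ] (∀ N → G N [] ℚ.≤ B)
    bound K 0≤K geo≤K = K ℚ.* (2ℚ ℚ.* K) , λ N → begin
      G N []                                     ≤⟨ sumTo-mono g≤ N ⟩
      sumTo N (λ n → r ℚ^.^ n ℚ.* (2ℚ ℚ.* K))    ≡⟨ sumTo-*ʳ (r ℚ^.^_) (2ℚ ℚ.* K) N ⟩
      sumTo N (r ℚ^.^_) ℚ.* (2ℚ ℚ.* K)           ≤⟨ *-monoʳ (*-nonNeg 0≤2 0≤K) (geo≤K N) ⟩
      K ℚ.* (2ℚ ℚ.* K)                           ∎
      where
      0≤2 : 0ℚ ℚ.≤ 2ℚ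
      0≤2 = +-nonNeg 0≤1 0≤1
      g≤ : ∀ n → g n [] ℚ.≤ r ℚ^.^ n ℚ.* (2ℚ ℚ.* K)
      g≤ n = begin
        g n []
          ≤⟨ sumTo-mono (summand-root n) (suc n) ⟩
        sumTo (suc n) (λ i → r ℚ^.^ i ℚ.* (r ℚ^.^ n ℚ.* 2ℚ))
          ≡⟨ sumTo-*ʳ (r ℚ^.^_) (r ℚ^.^ n ℚ.* 2ℚ) (suc n) ⟩
        sumTo (suc n) (r ℚ^.^_) ℚ.* (r ℚ^.^ n ℚ.* 2ℚ)
          ≤⟨ *-monoʳ (*-nonNeg (^-nonNeg n 0≤r) 0≤2) (geo≤K (suc n)) ⟩
        K ℚ.* (r ℚ^.^ n ℚ.* 2ℚ)                                 ≡⟨ ℚ.*-comm K (r ℚ^.^ n ℚ.* 2ℚ) ⟩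
        r ℚ^.^ n ℚ.* 2ℚ ℚ.* K                                   ≡⟨ ℚ.*-assoc (r ℚ^.^ n) 2ℚ K ⟩
        r ℚ^.^ n ℚ.* (2ℚ ℚ.* K)                                 ∎

  d : String → ℝ≥0
  d w .value  = supGale G w
  d w .finite = supGale-finite G G-gale G-mono 0<β (proj₂ G-bounded) w

  d-gale : IsGale t d
  d-gale = supGale-step G G-gale G-mono 0≤β (2^- t) β≤2^-t 2^-t≤β

  ↾-length : ∀ (S : Cantor) n → length (S ↾ n) ≡ n
  ↾-length S n = List.length-applyUpTo S n

  ↾∈level : ∀ {i n S} → threshold i ℕ.≤ n → S ∈ Xs i → S ↾ n ∈ₗ level i n
  ↾∈level {i} {n} {S} k≤n S∈Xᵢ = ∈ₗ.∈-filter⁺ (touches? i)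
    (subst (λ m → S ↾ n ∈ₗ strings m) (↾-length S n) (strings-complete (S ↾ n)))
    (subst (threshold i ℕ.≤_) (sym (↾-length S n)) k≤n , S , cong (S ↾_) (↾-length S n) , S∈Xᵢ)

  -- A single summand is kept: that of X_i at level N = i + m + k, where the initial segment of `S`
  -- belongs to the level. The shift by `i` in the level cancels the weight rⁱ and leaves γ^(m+k).
  -- The index is N + 1 because `G` sums over levels strictly below its index.
  G-large : ∀ {S i} m k → threshold i ℕ.≤ m → S ∈ Xs i →
            γ ℚ^.^ m ℚ.≤ G (suc (i ℕ.+ (m ℕ.+ k))) (S ↾ (i ℕ.+ (m ℕ.+ k)))
  G-large {S} {i} m k threshold≤m S∈Xᵢ = begin
    γ ℚ^.^ m                                    ≤⟨ ^-monoʳ 1≤γ (ℕ.m≤m+n m k) ⟩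
    γ ℚ^.^ (m ℕ.+ k)                            ≡⟨ ℚ.*-identityˡ _ ⟨
    1ℚ ℚ.* γ ℚ^.^ (m ℕ.+ k)
      ≡⟨ cong (ℚ._* γ ℚ^.^ (m ℕ.+ k)) (trans (ℚ.*-comm (r ℚ^.^ i) (γ ℚ^.^ i)) (γⁿrⁿ≡1 i)) ⟨
    r ℚ^.^ i ℚ.* γ ℚ^.^ i ℚ.* γ ℚ^.^ (m ℕ.+ k)
      ≡⟨ ℚ.*-assoc (r ℚ^.^ i) (γ ℚ^.^ i) (γ ℚ^.^ (m ℕ.+ k)) ⟩
    r ℚ^.^ i ℚ.* (γ ℚ^.^ i ℚ.* γ ℚ^.^ (m ℕ.+ k))
      ≡⟨ cong (r ℚ^.^ i ℚ.*_) (ℚ^.^-homo-* γ i (m ℕ.+ k)) ⟨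
    coefficient i N                             ≡⟨ ℚ.*-identityʳ _ ⟨
    coefficient i N ℚ.* 1ℚ
      ≤⟨ *-monoˡ (coefficient-nonNeg i N) (pointedSum-∈ (↾∈level {i} {N} {S} threshold≤N S∈Xᵢ)) ⟩
    summand N i w
      ≤⟨ sumTo-term {f = λ i → summand N i w} {i = i} {n = suc N}
           (λ i → summand-gale N i .nonNeg w) (ℕ.s≤s (ℕ.m≤m+n i (m ℕ.+ k))) ⟩
    g N w
      ≤⟨ sumTo-term {f = λ n → g n w} {i = N} {n = suc N} (λ n → g-gale n .nonNeg w) ℕ.≤-refl ⟩
    G (suc N) w                                 ∎
    where
    open ℚ.≤-Reasoning
    N = i ℕ.+ (m ℕ.+ k)
    w = S ↾ N
    threshold≤N : threshold i ℕ.≤ N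
    threshold≤N = ℕ.≤-trans threshold≤m (ℕ.≤-trans (ℕ.m≤m+n m k) (ℕ.m≤n+m (m ℕ.+ k) i))

  succeeds : ∀ {S} → S ∈ X → SucceedsStronglyOn d S
  succeeds {S} S∈X = let i , S∈Xᵢ = proj₂ (proj₁ small-cover) S∈X in
    (λ {q} _ → inj₂ (q ℚ.+ 1ℚ , tt , p<p+1)) , (λ {q} _ → eventually i S∈Xᵢ q)
    where
    eventually : ∀ i → S ∈ Xs i → ∀ q → below (liminf (λ n → value (d (S ↾ n)))) q
    eventually i S∈Xᵢ q =
      -- The three units above `q` pay for three strict inequalities: of the outer supremum and the
      -- inner infimum in `liminf`, and of the supremum defining `d`.
      let m , q+3≤γᵐ = powers-unbounded 0<γ-1 (q ℚ.+ 1ℚ ℚ.+ 1ℚ ℚ.+ 1ℚ)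
          m′ = m ℕ.+ threshold i
          γᵐ≤γᵐ′ = ^-monoʳ 1≤γ (ℕ.m≤m+n m (threshold i))
      in inj₂ (q ℚ.+ 1ℚ , (i ℕ.+ m′ , inj₂ (q ℚ.+ 1ℚ ℚ.+ 1ℚ , (λ k →
           subst (λ n → below (value (d (S ↾ n))) (q ℚ.+ 1ℚ ℚ.+ 1ℚ)) (sym (ℕ.+-assoc i m′ k))
             (inj₂ (_ , (suc (i ℕ.+ (m′ ℕ.+ k)) , refl) ,
               ℚ.<-≤-trans p<p+1 (ℚ.≤-trans q+3≤γᵐ (ℚ.≤-trans γᵐ≤γᵐ′
                 (G-large m′ k (ℕ.m≤n+m (threshold i) m) S∈Xᵢ)))))) , p<p+1)) , p<p+1)

  t∈𝓖ˢᵗʳ : t ∈ 𝓖ˢᵗʳ X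
  t∈𝓖ˢᵗʳ = d , d-gale , λ {S} → succeeds {S}

theorem4p4 : ExcludedMiddle (lsuc 0ℓ) → (X : Pred Cantor 0ℓ) → dimP X ≈ inf (𝓖ˢᵗʳ X)
theorem4p4 em X =
  inf-mono (𝓖ˢᵗʳ X) (λ s → P s X ≈ 0#)
    (λ s (d , gale , succeeds) larger →
      t larger , GaleToPacking.P≈0 {s = s} larger {d} gale succeeds , t≤q larger) ,
  inf-mono (λ s → P s X ≈ 0#) (𝓖ˢᵗʳ X)
    (λ s P≈0 larger → t larger , PackingToGale.t∈𝓖ˢᵗʳ em larger P≈0 , t≤q larger)
  where
  open Classical em
  open LargerExponent
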